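{- There is a randomized distributed algorithm such that for any unweighted undirected graph $G=(V,E)$ on $n$ vertices, any integer $k$ with $1\le k\le \ln n$, and any real $c>5$, the algorithm, run on $G$ with parameters $k$ and $c$, computes, with probability at least $1-5/c$, a strong $\left(2k-2,\ 4k(cn)^{1/k}\right)$ network decomposition of $G$. The number of rounds required is $O\left(k^2(cn)^{1/k}\right)$, and each message consists of $O(1)$ words. (The implied constants are absolute.)
   Context: Network decomposition: let $\mathcal{P}$ be a partition of $V$ into disjoint clusters. The supergraph $\mathcal{G}(\mathcal{P})$ has the clusters as vertices, and two distinct clusters $C\neq C'$ are adjacent iff some edge of $G$ joins a vertex of $C$ to a vertex of $C'$. The strong diameter of a cluster $C$ is $\max_{v,v'\in C} d_{G(C)}(v,v')$, where $G(C)$ is the subgraph of $G$ induced by $C$ and $d_{G(C)}$ is its shortest-path distance. $\mathcal{P}$ is a strong $(D,\chi)$ network decomposition of $G$ if every cluster has strong diameter at most $D$ and $\mathcal{G}(\mathcal{P})$ can be properly colored with at most $\chi$ colors. Model: each vertex of $G$ hosts a processor with a distinct identity number from $\{1,\dots,n\}$. The processors have private randomness and communicate over the edges of $G$ in synchronous rounds; the running time is the number of rounds. A word is $O(\log n)$ bits, so messages of $O(1)$ words fit the CONGEST model. The algorithm computes a partition when, at its end, each vertex knows (an identifier of) its cluster. -}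

module Defs where

open import Algebra.Definitions.RawSemiring using (_^_)
open import Data.Bool using (Bool; true; false; if_then_else_)
open import Data.Empty using (⊥)
open import Data.Fin using (Fin)
open import Data.Integer using (+_)
open import Data.List using (List; []; _∷_; length; map; filterᵇ; cartesianProductWith)
open import Data.List.Properties using (length-++; length-map)
open import Data.Maybe using (Maybe; just; nothing)
open import Data.Nat as ℕ using (ℕ; zero; suc; _!)
open import Data.Nat.Logarithm using (⌈log₂_⌉)
import Data.Nat.Properties as ℕₚ
open import Data.Product using (∃; _×_; _,_)
open import Data.Rational
open import Data.Rational.Properties
open import Data.Sum using (_⊎_; inj₁; inj₂)
open import Data.Vec using (Vec; []; _∷_; lookup)
open import Relation.Binary.PropositionalEquality
open import Relation.Nullary using (yes; no; contradiction)
open import Relation.Nullary.Decidable using (toWitness)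

infixr 8 _^ℚ_
_^ℚ_ : ℚ → ℕ → ℚ
_^ℚ_ = _^_ +-*-rawSemiring

fromℕ : ℕ → ℚ
fromℕ n = + n / 1

private
  variable
    p q r s t : ℚ

  dense : p < q → ∃ λ m → p < m × m < q
  dense = <-dense

  p-1<p : ∀ p → p - 1ℚ < p
  p-1<p p = subst (p - 1ℚ <_) (+-identityʳ p) (+-monoʳ-< p (negative⁻¹ (- 1ℚ)))

  p<p+1 : ∀ p → p < p + 1ℚ
  p<p+1 p = subst (_< p + 1ℚ) (+-identityʳ p) (+-monoʳ-< p (positive⁻¹ 1ℚ))

  0<1 : 0ℚ < 1ℚ
  0<1 = positive⁻¹ 1ℚ

  *-monoˡ-≤ : 0ℚ ≤ r → p ≤ q → r * p ≤ r * q
  *-monoˡ-≤ {r} 0≤r = *-monoˡ-≤-nonNeg r {{nonNegative 0≤r}}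

  *-monoʳ-≤ : 0ℚ ≤ r → p ≤ q → p * r ≤ q * r
  *-monoʳ-≤ {r} 0≤r = *-monoʳ-≤-nonNeg r {{nonNegative 0≤r}}

  *-monoʳ-< : 0ℚ < r → p < q → r * p < r * q
  *-monoʳ-< {r} 0<r = *-monoʳ-<-pos r {{positive 0<r}}

  *-monoˡ-< : 0ℚ < r → p < q → p * r < q * r
  *-monoˡ-< {r} 0<r = *-monoˡ-<-pos r {{positive 0<r}}

  0≤* : 0ℚ ≤ p → 0ℚ ≤ q → 0ℚ ≤ p * q
  0≤* {p} {q} 0≤p 0≤q = subst (_≤ p * q) (*-zeroʳ p) (*-monoˡ-≤ 0≤p 0≤q)

  0<* : 0ℚ < p → 0ℚ < q → 0ℚ < p * q
  0<* {p} {q} 0<p 0<q = subst (_< p * q) (*-zeroʳ p) (*-monoʳ-< 0<p 0<q)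

  inv : 0ℚ < p → ∃ λ i → p * i ≡ 1ℚ × 0ℚ < i
  inv {p} 0<p = 1/ p , *-inverseʳ p , positive⁻¹ (1/ p) {{1/pos⇒pos p {{positive 0<p}}}}
    where instance _ = pos⇒nonZero p {{positive 0<p}}

  quotient : 0ℚ < p → ∀ q → ∃ λ d → p * d ≡ q
  quotient {p} 0<p q with inv 0<p
  ... | i , pi≡1 , _ = i * q , trans (sym (*-assoc p i q)) (trans (cong (_* q) pi≡1) (*-identityˡ q))

  cancel-< : 0ℚ < r → r * p < r * q → p < q
  cancel-< {r} 0<r = *-cancelˡ-<-nonNeg r {{pos⇒nonNeg r {{positive 0<r}}}}

  ≤⊎> : ∀ p q → p ≤ q ⊎ q < p
  ≤⊎> p q with p ≤? q
  ... | yes p≤q = inj₁ p≤q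
  ... | no  p≰q = inj₂ (≰⇒> p≰q)

  *-open-above : 0ℚ ≤ t → q * t < s → ∃ λ r → q < r × r * t < s
  *-open-above {t} {q} {s} 0≤t qt<s with ≤⊎> t 0ℚ
  ... | inj₁ t≤0 rewrite ≤-antisym t≤0 0≤t =
    q + 1ℚ , p<p+1 q ,
    subst (_< s) (trans (*-zeroʳ q) (sym (*-zeroʳ (q + 1ℚ)))) qt<s
  ... | inj₂ 0<t with dense qt<s
  ...   | m , qt<m , m<s with quotient 0<t m
  ...     | d , td≡m =
    d , cancel-< 0<t (subst₂ _<_ (*-comm q t) (sym td≡m) qt<m) ,
    subst (_< s) (trans (sym td≡m) (*-comm t d)) m<s

  *-open-below : 0ℚ < q → 0ℚ < t → s < q * t → ∃ λ r → 0ℚ < r × r < q × s < r * t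
  *-open-below {q} {t} {s} 0<q 0<t s<qt with ≤⊎> s 0ℚ
  ... | inj₁ s≤0 with dense 0<q
  ...   | r , 0<r , r<q = r , 0<r , r<q , ≤-<-trans s≤0 (0<* 0<r 0<t)
  *-open-below {q} {t} {s} 0<q 0<t s<qt | inj₂ 0<s with dense s<qt
  ... | m , s<m , m<qt with quotient 0<t m
  ...   | d , td≡m =
    d ,
    cancel-< 0<t (subst₂ _<_ (sym (*-zeroʳ t)) (sym td≡m) (<-trans 0<s s<m)) ,
    cancel-< 0<t (subst₂ _<_ (sym td≡m) (*-comm q t) m<qt) ,
    subst (s <_) (trans (sym td≡m) (*-comm t d)) s<m

  ^-nonNeg : ∀ k → 0ℚ ≤ q → 0ℚ ≤ q ^ℚ k
  ^-nonNeg zero    0≤q = <⇒≤ 0<1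
  ^-nonNeg (suc k) 0≤q = 0≤* 0≤q (^-nonNeg k 0≤q)

  ^-pos : ∀ k → 0ℚ < q → 0ℚ < q ^ℚ k
  ^-pos zero    0<q = 0<1
  ^-pos (suc k) 0<q = 0<* 0<q (^-pos k 0<q)

  ^-mono-≤ : ∀ k → 0ℚ ≤ p → p ≤ q → p ^ℚ k ≤ q ^ℚ k
  ^-mono-≤ zero    0≤p p≤q = ≤-refl
  ^-mono-≤ (suc k) 0≤p p≤q =
    ≤-trans (*-monoˡ-≤ 0≤p (^-mono-≤ k 0≤p p≤q))
            (*-monoʳ-≤ (^-nonNeg k (≤-trans 0≤p p≤q)) p≤q)

  ^-mono-< : ∀ k .{{_ : ℕ.NonZero k}} → 0ℚ ≤ p → p < q → p ^ℚ k < q ^ℚ k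
  ^-mono-< (suc k) 0≤p p<q =
    ≤-<-trans (*-monoˡ-≤ 0≤p (^-mono-≤ k 0≤p (<⇒≤ p<q)))
              (*-monoˡ-< (^-pos k (≤-<-trans 0≤p p<q)) p<q)

  ^-expand : ∀ k .{{_ : ℕ.NonZero k}} → 1ℚ ≤ q → q ≤ q ^ℚ k
  ^-expand {q} (suc k) 1≤q =
    subst (_≤ q * q ^ℚ k) (*-identityʳ q) (*-monoˡ-≤ (≤-trans (<⇒≤ 0<1) 1≤q) (1≤^ k))
    where
    1≤^ : ∀ k → 1ℚ ≤ q ^ℚ k
    1≤^ zero    = ≤-refl
    1≤^ (suc k) = ≤-trans (1≤^ k)
      (subst (_≤ q * q ^ℚ k) (*-identityˡ (q ^ℚ k))
             (*-monoʳ-≤ (^-nonNeg k (≤-trans (<⇒≤ 0<1) 1≤q)) 1≤q))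

  ^-open-above : ∀ k → 0ℚ ≤ q → q ^ℚ k < s → ∃ λ r → q < r × r ^ℚ k < s
  ^-open-above {q} zero    0≤q 1<s = q + 1ℚ , p<p+1 q , 1<s
  ^-open-above {q} {s} (suc k) 0≤q lt
    with *-open-above {q} {q ^ℚ k} 0≤q (subst (_< s) (*-comm q (q ^ℚ k)) lt)
  ... | t , q^k<t , tq<s
    with *-open-above {t} {q} (≤-trans (^-nonNeg k 0≤q) (<⇒≤ q^k<t))
                      (subst (_< s) (*-comm t q) tq<s)
       | ^-open-above k 0≤q q^k<t
  ... | r , q<r , rt<s | r′ , q<r′ , r′^k<t with ≤⊎> r r′
  ...   | inj₁ r≤r′ = r , q<r , ≤-<-trans
    (*-monoˡ-≤ 0≤r (≤-trans (^-mono-≤ k 0≤r r≤r′) (<⇒≤ r′^k<t))) rt<s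
    where 0≤r = ≤-trans 0≤q (<⇒≤ q<r)
  ...   | inj₂ r′<r = r′ , q<r′ , ≤-<-trans
    (≤-trans (*-monoʳ-≤ (^-nonNeg k 0≤r′) (<⇒≤ r′<r))
             (*-monoˡ-≤ (≤-trans 0≤r′ (<⇒≤ r′<r)) (<⇒≤ r′^k<t))) rt<s
    where 0≤r′ = ≤-trans 0≤q (<⇒≤ q<r′)

  ^-open-below : ∀ k → 0ℚ < q → s < q ^ℚ k → ∃ λ r → 0ℚ < r × r < q × s < r ^ℚ k
  ^-open-below zero 0<q s<1 with dense 0<q
  ... | r , 0<r , r<q = r , 0<r , r<q , s<1
  ^-open-below {q} {s} (suc k) 0<q lt
    with *-open-below {q ^ℚ k} {q} (^-pos k 0<q) 0<q (subst (s <_) (*-comm q (q ^ℚ k)) lt)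
  ... | t , 0<t , t<q^k , s<tq
    with *-open-below {q} {t} 0<q 0<t (subst (s <_) (*-comm t q) s<tq)
       | ^-open-below k 0<q t<q^k
  ... | r , 0<r , r<q , s<rt | r′ , 0<r′ , r′<q , t<r′^k with ≤⊎> r r′
  ...   | inj₁ r≤r′ = r′ , 0<r′ , r′<q , <-≤-trans s<rt
    (≤-trans (*-monoʳ-≤ (<⇒≤ 0<t) r≤r′) (*-monoˡ-≤ (<⇒≤ 0<r′) (<⇒≤ t<r′^k)))
  ...   | inj₂ r′<r = r , 0<r , r<q , <-≤-trans s<rt
    (*-monoˡ-≤ (<⇒≤ 0<r)
      (≤-trans (<⇒≤ t<r′^k) (^-mono-≤ k (<⇒≤ 0<r′) (<⇒≤ r′<r))))

-- Dedekind reals: Lower q means q < x and Upper q means x < q.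
record ℝ : Set₁ where
  field
    Lower Upper     : ℚ → Set
    lower-inhabited : ∃ Lower
    upper-inhabited : ∃ Upper
    lower-closed    : p ≤ q → Lower q → Lower p
    upper-closed    : p ≤ q → Upper p → Upper q
    lower-open      : Lower q → ∃ λ r → q < r × Lower r
    upper-open      : Upper q → ∃ λ r → r < q × Upper r
    disjoint        : Lower q → Upper q → ⊥
    located         : p < q → Lower p ⊎ Upper q

  lower<upper : Lower p → Upper q → p < q
  lower<upper {p} {q} l u with ≤⊎> q p
  ... | inj₁ q≤p = contradiction u (disjoint (lower-closed q≤p l))
  ... | inj₂ p<q = p<q

open ℝ

infix 4 _<ℝ_ _≤ℝ_

_<ℝ_ : ℝ → ℝ → Set
x <ℝ y = ∃ λ q → Upper x q × Lower y q

_≤ℝ_ : ℝ → ℝ → Set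
x ≤ℝ y = ∀ {q} → Lower x q → Lower y q

⟦_⟧ : ℚ → ℝ
⟦ p ⟧ = record
  { Lower           = _< p
  ; Upper           = p <_
  ; lower-inhabited = _ , p-1<p p
  ; upper-inhabited = _ , p<p+1 p
  ; lower-closed    = ≤-<-trans
  ; upper-closed    = λ q≤r p<q → <-≤-trans p<q q≤r
  ; lower-open      = λ q<p → let m , q<m , m<p = dense q<p in m , q<m , m<p
  ; upper-open      = λ p<q → let m , p<m , m<q = dense p<q in m , m<q , p<m
  ; disjoint        = <-asym
  ; located         = loc
  }
  where
  loc : q < r → q < p ⊎ p < r
  loc {q} q<r with ≤⊎> p q
  ... | inj₁ p≤q = inj₂ (≤-<-trans p≤q q<r)
  ... | inj₂ q<p = inj₁ q<p

infixl 6 _⊖_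
_⊖_ : ℚ → ℝ → ℝ
p ⊖ x = record
  { Lower           = λ q → Upper x (p - q)
  ; Upper           = λ q → Lower x (p - q)
  ; lower-inhabited = let u , xu = upper-inhabited x in p - u , subst (Upper x) (sym (flip u)) xu
  ; upper-inhabited = let l , xl = lower-inhabited x in p - l , subst (Lower x) (sym (flip l)) xl
  ; lower-closed    = λ q≤r → upper-closed x (anti-≤ q≤r)
  ; upper-closed    = λ q≤r → lower-closed x (anti-≤ q≤r)
  ; lower-open      = λ {q} xu → let r , r<p-q , xr = upper-open x xu in
      p - r , subst (_< p - r) (flip q) (anti-< r<p-q) , subst (Upper x) (sym (flip r)) xr
  ; upper-open      = λ {q} xl → let r , p-q<r , xr = lower-open x xl in
      p - r , subst (p - r <_) (flip q) (anti-< p-q<r) , subst (Lower x) (sym (flip r)) xr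
  ; disjoint        = λ u l → disjoint x l u
  ; located         = loc
  }
  where
  flip : ∀ q → p - (p - q) ≡ q
  flip q = begin
    p + - (p + - q)      ≡⟨ cong (_+_ p) (neg-distrib-+ p (- q)) ⟩
    p + (- p + - - q)    ≡⟨ sym (+-assoc p (- p) (- - q)) ⟩
    (p + - p) + - - q    ≡⟨ cong (_+ - - q) (+-inverseʳ p) ⟩
    0ℚ + - - q           ≡⟨ +-identityˡ (- - q) ⟩
    - - q                ≡⟨ neg-involutive q ⟩
    q                    ∎
    where
    open ≡-Reasoning
    neg-involutive : ∀ q → - - q ≡ q
    neg-involutive q = trans (sym (+-identityˡ (- - q)))
      (trans (cong (_+ - - q) (sym (+-inverseʳ q)))
      (trans (+-assoc q (- q) (- - q))
      (trans (cong (_+_ q) (+-inverseʳ (- q))) (+-identityʳ q))))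
  anti-≤ : q ≤ r → p - r ≤ p - q
  anti-≤ q≤r = +-monoʳ-≤ p (neg-antimono-≤ q≤r)
  anti-< : q < r → p - r < p - q
  anti-< q<r = +-monoʳ-< p (neg-antimono-< q<r)
  loc : q < r → Upper x (p - q) ⊎ Lower x (p - r)
  loc q<r with located x (anti-< q<r)
  ... | inj₁ l = inj₂ l
  ... | inj₂ u = inj₁ u

infixl 7 _·_
_·_ : ℕ → ℝ → ℝ
a · x = record
  { Lower           = λ q → ∃ λ p → Lower x p × q < A * p
  ; Upper           = λ q → ∃ λ p → Upper x p × A * p < q
  ; lower-inhabited = let l , xl = lower-inhabited x in A * l - 1ℚ , l , xl , p-1<p (A * l)
  ; upper-inhabited = let u , xu = upper-inhabited x in A * u + 1ℚ , u , xu , p<p+1 (A * u)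
  ; lower-closed    = λ { q≤r (p , xp , r<Ap) → p , xp , ≤-<-trans q≤r r<Ap }
  ; upper-closed    = λ { q≤r (p , xp , Ap<q) → p , xp , <-≤-trans Ap<q q≤r }
  ; lower-open      = λ { (p , xp , q<Ap) → let m , q<m , m<Ap = dense q<Ap in m , q<m , p , xp , m<Ap }
  ; upper-open      = λ { (p , xp , Ap<q) → let m , Ap<m , m<q = dense Ap<q in m , m<q , p , xp , Ap<m }
  ; disjoint        = λ { (l , xl , q<Al) (u , xu , Au<q) →
      <-irrefl refl (<-trans q<Al (≤-<-trans (*-monoˡ-≤ 0≤A (<⇒≤ (lower<upper x xl xu))) Au<q)) }
  ; located         = loc A 0≤A
  }
  where
  A = fromℕ a
  0≤A : 0ℚ ≤ A
  0≤A = nonNegative⁻¹ A {{normalize-nonNeg a 1}}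
  loc : ∀ A → 0ℚ ≤ A → q < r →
        (∃ λ p → Lower x p × q < A * p) ⊎ (∃ λ p → Upper x p × A * p < r)
  loc {q} {r} A 0≤A q<r with ≤⊎> A 0ℚ
  ... | inj₁ A≤0 rewrite ≤-antisym A≤0 0≤A with ≤⊎> 0ℚ q
  ...   | inj₁ 0≤q = let u , xu = upper-inhabited x in
    inj₂ (u , xu , subst (_< r) (sym (*-zeroˡ u)) (≤-<-trans 0≤q q<r))
  ...   | inj₂ q<0 = let l , xl = lower-inhabited x in
    inj₁ (l , xl , subst (q <_) (sym (*-zeroˡ l)) q<0)
  loc {q} {r} A 0≤A q<r | inj₂ 0<A with dense q<r
  ... | m , q<m , m<r with dense m<r
  ...   | m′ , m<m′ , m′<r with quotient 0<A m | quotient 0<A m′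
  ...     | d , Ad≡m | d′ , Ad′≡m′
    with located x (cancel-< 0<A (subst₂ _<_ (sym Ad≡m) (sym Ad′≡m′) m<m′))
  ...       | inj₁ l = inj₁ (d , l , subst (q <_) (sym Ad≡m) q<m)
  ...       | inj₂ u = inj₂ (d′ , u , subst (_< r) (sym Ad′≡m′) m′<r)

recip : (x : ℝ) → ⟦ 0ℚ ⟧ <ℝ x → ℝ
recip x (z , 0<z , xz) = record
  { Lower           = Lo
  ; Upper           = Up
  ; lower-inhabited = let u , xu = upper-inhabited x in
      0ℚ , u , xu , subst (_< 1ℚ) (sym (*-zeroʳ u)) 0<1
  ; upper-inhabited = let d , zd≡1+1 = quotient 0<z (1ℚ + 1ℚ) in
      d , z , xz , 0<z , subst (1ℚ <_) (sym zd≡1+1) (p<p+1 1ℚ)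
  ; lower-closed    = λ { q≤r (p , xp , pr<1) →
      p , xp , ≤-<-trans (*-monoˡ-≤ (<⇒≤ (0<u xp)) q≤r) pr<1 }
  ; upper-closed    = λ { q≤r (p , xp , 0<p , 1<pq) →
      p , xp , 0<p , <-≤-trans 1<pq (*-monoˡ-≤ (<⇒≤ 0<p) q≤r) }
  ; lower-open      = lo-open
  ; upper-open      = up-open
  ; disjoint        = disj
  ; located         = loc
  }
  where
  Lo Up : ℚ → Set
  Lo q = ∃ λ p → Upper x p × p * q < 1ℚ
  Up q = ∃ λ p → Lower x p × 0ℚ < p × 1ℚ < p * q
  0<u : Upper x p → 0ℚ < p
  0<u xp = <-trans 0<z (lower<upper x xz xp)
  lo-open : Lo q → ∃ λ r → q < r × Lo r
  lo-open (p , xp , pq<1) with dense pq<1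
  ... | m , pq<m , m<1 with quotient (0<u xp) m
  ...   | d , pd≡m = d , cancel-< (0<u xp) (subst (_ <_) (sym pd≡m) pq<m) ,
                     p , xp , subst (_< 1ℚ) (sym pd≡m) m<1
  up-open : Up q → ∃ λ r → r < q × Up r
  up-open (p , xp , 0<p , 1<pq) with dense 1<pq
  ... | m , 1<m , m<pq with quotient 0<p m
  ...   | d , pd≡m = d , cancel-< 0<p (subst (_< _) (sym pd≡m) m<pq) ,
                     p , xp , 0<p , subst (1ℚ <_) (sym pd≡m) 1<m
  disj : Lo q → Up q → ⊥
  disj {q} (u , xu , uq<1) (l , xl , 0<l , 1<lq) =
    <-asym (<-trans 1<lq (*-monoˡ-< 0<q (lower<upper x xl xu))) uq<1
    where
    0<q : 0ℚ < q
    0<q = cancel-< 0<l (subst (_< l * q) (sym (*-zeroʳ l)) (<-trans 0<1 1<lq))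
  loc : q < r → Lo q ⊎ Up r
  loc {q} {r} q<r with ≤⊎> q 0ℚ
  ... | inj₁ q≤0 = let u , xu = upper-inhabited x in
    inj₁ (u , xu , ≤-<-trans (subst (u * q ≤_) (*-zeroʳ u) (*-monoˡ-≤ (<⇒≤ (0<u xu)) q≤0)) 0<1)
  ... | inj₂ 0<q with <-trans 0<q q<r
  ...   | 0<r with inv 0<q | inv 0<r
  ...     | i , qi≡1 , 0<i | j , rj≡1 , 0<j with dense j<i
    where
    j<i : j < i
    j<i = cancel-< 0<q (subst (q * j <_) (trans rj≡1 (sym qi≡1)) (*-monoˡ-< 0<j q<r))
  ...       | m , j<m , m<i with dense m<i
  ...         | m′ , m<m′ , m′<i with located x m<m′
  ...           | inj₁ l = inj₂ (m , l , <-trans 0<j j<m ,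
    subst₂ _<_ rj≡1 (*-comm r m) (*-monoʳ-< 0<r j<m))
  ...           | inj₂ u = inj₁ (m′ , u ,
    subst₂ _<_ (*-comm q m′) qi≡1 (*-monoʳ-< 0<q m′<i))

-- For x < 0 this is 0.
root : (k : ℕ) .{{_ : ℕ.NonZero k}} → ℝ → ℝ
root k x = record
  { Lower           = Lo
  ; Upper           = Up
  ; lower-inhabited = - 1ℚ , inj₁ (negative⁻¹ (- 1ℚ))
  ; upper-inhabited = up-inh
  ; lower-closed    = lo-closed
  ; upper-closed    = λ { q≤r (0<q , u) →
      <-≤-trans 0<q q≤r , upper-closed x (^-mono-≤ k (<⇒≤ 0<q) q≤r) u }
  ; lower-open      = lo-open
  ; upper-open      = up-open
  ; disjoint        = λ { (inj₁ q<0) (0<q , _) → <-asym q<0 0<q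
                        ; (inj₂ l)   (_ , u)   → disjoint x l u }
  ; located         = loc
  }
  where
  Lo Up : ℚ → Set
  Lo q = q < 0ℚ ⊎ Lower x (q ^ℚ k)
  Up q = 0ℚ < q × Upper x (q ^ℚ k)
  up-inh : ∃ Up
  up-inh with upper-inhabited x
  ... | u , xu with ≤⊎> u 1ℚ
  ...   | inj₁ u≤1 = 1ℚ , 0<1 , upper-closed x (≤-trans u≤1 (^-expand k ≤-refl)) xu
  ...   | inj₂ 1<u = u , <-trans 0<1 1<u , upper-closed x (^-expand k (<⇒≤ 1<u)) xu
  lo-closed : q ≤ r → Lo r → Lo q
  lo-closed q≤r (inj₁ r<0) = inj₁ (≤-<-trans q≤r r<0)
  lo-closed {q} q≤r (inj₂ l) with ≤⊎> 0ℚ q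
  ... | inj₁ 0≤q = inj₂ (lower-closed x (^-mono-≤ k 0≤q q≤r) l)
  ... | inj₂ q<0 = inj₁ q<0
  lo-open : Lo q → ∃ λ r → q < r × Lo r
  lo-open {q} l with ≤⊎> 0ℚ q
  lo-open {q} l | inj₂ q<0 with dense q<0
  ... | r , q<r , r<0 = r , q<r , inj₁ r<0
  lo-open {q} (inj₁ q<0) | inj₁ 0≤q = contradiction (≤-<-trans 0≤q q<0) (<-irrefl refl)
  lo-open {q} (inj₂ l)   | inj₁ 0≤q with lower-open x l
  ... | s , q^k<s , xs with ^-open-above k 0≤q q^k<s
  ...   | r , q<r , r^k<s = r , q<r , inj₂ (lower-closed x (<⇒≤ r^k<s) xs)
  up-open : Up q → ∃ λ r → r < q × Up r
  up-open (0<q , u) with upper-open x u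
  ... | s , s<q^k , xs with ^-open-below k 0<q s<q^k
  ...   | r , 0<r , r<q , s<r^k = r , r<q , 0<r , upper-closed x (<⇒≤ s<r^k) xs
  loc : q < r → Lo q ⊎ Up r
  loc {q} q<r with ≤⊎> 0ℚ q
  ... | inj₂ q<0 = inj₁ (inj₁ q<0)
  ... | inj₁ 0≤q with located x (^-mono-< k 0≤q q<r)
  ...   | inj₁ l = inj₁ (inj₂ l)
  ...   | inj₂ u = inj₂ (≤-<-trans 0≤q q<r , u)

5<⇒0< : ∀ x → ⟦ fromℕ 5 ⟧ <ℝ x → ⟦ 0ℚ ⟧ <ℝ x
5<⇒0< x (q , 5<q , xq) = q , <-trans (toWitness {a? = 0ℚ <? fromℕ 5} _) 5<q , xq

-- The partial sum 1/0! + 1/1! + ⋯ + 1/m! of the series for e.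
eSum : ℕ → ℚ
eSum zero    = 1ℚ
eSum (suc m) = eSum m + (+ 1 / (suc m !)) {{suc m ℕₚ.!≢0}}

-- k ≤ ln n, that is eᵏ ≤ n, where e is the supremum of the partial sums.
infix 4 _≤ln_
_≤ln_ : ℕ → ℕ → Set
k ≤ln n = ∀ m → eSum m ^ℚ k ≤ fromℕ n

record Graph (n : ℕ) : Set where
  field
    adj       : Fin n → Fin n → Bool
    symmetric : ∀ u v → adj u v ≡ adj v u
    loopless  : ∀ v → adj v v ≡ false

  Adj : Fin n → Fin n → Set
  Adj u v = adj u v ≡ true

open Graph public

module _ {n : ℕ} (G : Graph n) where

  -- Walks of the given length in the subgraph induced by S.
  data Walk (S : Fin n → Set) : Fin n → Fin n → ℕ → Set where
    here : ∀ {v} → S v → Walk S v v 0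
    step : ∀ {u v w ℓ} → S u → Adj G u v → Walk S v w ℓ → Walk S u w (suc ℓ)

  IsDistance : (S : Fin n → Set) → Fin n → Fin n → ℕ → Set
  IsDistance S u v d = Walk S u v d × (∀ ℓ → Walk S u v ℓ → d ℕ.≤ ℓ)

  StrongDiameterAtMost : ℕ → (Fin n → Set) → Set
  StrongDiameterAtMost D S =
    ∀ u v → S u → S v → ∃ λ d → IsDistance S u v d × d ℕ.≤ D

  -- A partition of the vertices is given by a map sending each vertex to an
  -- identifier of its cluster.
  module _ (cluster : Fin n → ℕ) where

    Cluster : ℕ → Fin n → Set
    Cluster C v = cluster v ≡ C

    SuperAdj : ℕ → ℕ → Set
    SuperAdj C C′ = C ≢ C′ ×
      ∃ λ u → ∃ λ v → Cluster C u × Cluster C′ v × Adj G u v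

    -- Identifiers of no vertex are isolated in SuperAdj, so colouring them too
    -- costs nothing once there is a vertex.
    SupergraphColorable : ℕ → Set
    SupergraphColorable m =
      ∃ λ (color : ℕ → Fin m) → ∀ C C′ → SuperAdj C C′ → color C ≢ color C′

    IsStrongDecomposition : ℕ → ℝ → Set
    IsStrongDecomposition D χ =
      (∀ C → StrongDiameterAtMost D (Cluster C)) ×
      ∃ λ m → ⟦ fromℕ m ⟧ ≤ℝ χ × SupergraphColorable m

Message : Set
Message = List Bool

-- The program run by every processor of a network on n vertices.  Vertices are
-- named by their identity numbers; messages are addressed by the identity of
-- the neighbour at the other end of the edge.
record Protocol (n : ℕ) : Set₁ where
  field
    State   : Set
    coins   : ℕ
    rounds  : ℕ
    -- own identity, which identities are neighbours, own coin tosses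
    init    : Fin n → (Fin n → Bool) → Vec Bool coins → State
    send    : State → Fin n → Message
    receive : State → (Fin n → Maybe Message) → State
    output  : State → ℕ

module Execution {n : ℕ} (P : Protocol n) (G : Graph n) where
  open Protocol P

  Coins : Set
  Coins = Vec (Vec Bool coins) n

  state : Coins → ℕ → Fin n → State
  state ω zero    v = init v (adj G v) (lookup ω v)
  state ω (suc t) v = receive (state ω t v)
    λ u → if adj G v u then just (send (state ω t u) v) else nothing

  clustering : Coins → Fin n → ℕ
  clustering ω v = output (state ω rounds v)

  MessagesAtMost : ℕ → Set
  MessagesAtMost b = ∀ ω t u v → t ℕ.< rounds → Adj G u v →
    length (send (state ω t u) v) ℕ.≤ b

Algorithm : Set₁
Algorithm = (n k : ℕ) (c : ℝ) → Protocol n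

wordLength : ℕ → ℕ
wordLength n = ⌈log₂ n ⌉

allVecs : ∀ {A : Set} → List A → ∀ n → List (Vec A n)
allVecs xs zero    = [] ∷ []
allVecs xs (suc n) = cartesianProductWith _∷_ xs (allVecs xs n)

allCoins : ∀ b n → List (Vec (Vec Bool b) n)
allCoins b n = allVecs (allVecs (false ∷ true ∷ []) b) n

length-cartesianProductWith : ∀ {A B C : Set} (f : A → B → C) xs ys →
  length (cartesianProductWith f xs ys) ≡ length xs ℕ.* length ys
length-cartesianProductWith f []       ys = refl
length-cartesianProductWith f (x ∷ xs) ys =
  trans (length-++ (map (f x) ys))
        (cong₂ ℕ._+_ (length-map (f x) ys) (length-cartesianProductWith f xs ys))

length-allVecs : ∀ {A : Set} (xs : List A) n → length (allVecs xs n) ≡ length xs ℕ.^ n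
length-allVecs xs zero    = refl
length-allVecs xs (suc n) =
  trans (length-cartesianProductWith _∷_ xs (allVecs xs n))
        (cong (length xs ℕ.*_) (length-allVecs xs n))

length-allCoins : ∀ b n → length (allCoins b n) ≡ (2 ℕ.^ b) ℕ.^ n
length-allCoins b n = trans (length-allVecs (allVecs (false ∷ true ∷ []) b) n)
                            (cong (ℕ._^ n) (length-allVecs (false ∷ true ∷ []) b))

Pr : ∀ {b n} → (Vec (Vec Bool b) n → Bool) → ℚ
Pr {b} {n} E = + length (filterᵇ E (allCoins b n)) / length (allCoins b n)
  where instance
    outcomes≢0 : ℕ.NonZero (length (allCoins b n))
    outcomes≢0 = subst ℕ.NonZero (sym (length-allCoins b n))
      (ℕₚ.m^n≢0 (2 ℕ.^ b) n {{ℕₚ.m^n≢0 2 b}})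

-- E ranges over decidable events so that outcomes can be counted; classically
-- the bound says exactly that S itself has probability at least p.
ProbabilityAtLeast : ∀ {b n} → ℝ → (Vec (Vec Bool b) n → Set) → Set
ProbabilityAtLeast p S =
  ∃ λ E → (∀ ω → E ω ≡ true → S ω) × p ≤ℝ ⟦ Pr E ⟧

-- The algorithm runs τ = 2ky phases, where y is about (cn)^(1/k).  In a phase
-- every unclustered vertex u draws a truncated geometric radius r_u ≤ k + 1 and
-- emits its identity at time k − r_u (at time 0 if r_u = k + 1); identities
-- travel through unclustered vertices at one edge per round.  A vertex y joins v
-- if at some time v alone has reached y and no larger identity arrives in the
-- next round.  Then the vertices on a walk from v to y that v followed join v as
-- well, and adjacent vertices that join in the same phase join the same v, so
-- the clusters have strong diameter at most 2(k − 1) and phases serve as colours.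
--
-- If v is the first identity to reach y (larger identities winning ties), then y
-- joins v as soon as r_v is larger by one than needed for that, so y joins with
-- at least the success probability q of the geometric law, up to the truncation.
-- In phase t = 0, …, τ − 1 we take q = (k + 1)/(τ + k − t).  The probability that
-- y remains unclustered is then a ratio of products of k + 1 consecutive integers, which
-- vanishes at the end and cancels against q^(k + 1), the probability of a
-- truncated radius: each phase contributes the same amount to the failures.
module Submission where

open import Defs
open import Data.Bool using (Bool; true; false; if_then_else_; not; _∧_; T)
import Data.Bool.Properties as Bool
open import Data.Fin as Fin using (Fin; zero; suc; toℕ)
import Data.Fin.Properties as Fin
open import Data.List as List using (List; []; _∷_; _++_; length; cartesianProductWith; allFin; filterᵇ)
open import Data.List.Membership.Propositional using (_∈_)
open import Data.List.Membership.Propositional.Properties using (∈-allFin)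
import Data.List.Properties as List
open import Data.List.Relation.Unary.Any using (here; there)
open import Data.Maybe using (Maybe; just; nothing; maybe)
open import Data.Nat.Tactic.RingSolver using (solve-∀)
open import Data.Product using (∃; _×_; _,_; proj₁; proj₂)
open import Data.Sum using (_⊎_; inj₁; inj₂; [_,_]′)
open import Data.Vec as Vec using (Vec; []; _∷_; lookup; updateAt; take; drop)
import Data.Vec.Properties as Vec
open import Function using (_∘_; const; Equivalence; mk⇔)
open import Induction.WellFounded using (Acc; acc)
open import Relation.Binary.Definitions using (tri<; tri≈; tri>)
open import Relation.Binary.PropositionalEquality hiding (J)
open import Relation.Nullary using (Dec; ¬_; contradiction; does; yes; no)
open import Relation.Nullary.Decidable
  using (map′; _×-dec_; _→-dec_; ¬?; dec-true; decidable-stable; does-⇔; toWitness)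
open import Relation.Unary using (Decidable)

-- Rational approximations of c and (cn)^(1/k)

-- The coins are fair and finite in number, so all estimates compare counts of outcomes, and
-- independence means redrawing one block of coins while the others stay fixed. The success
-- probability q must then be a dyadic fraction. It is rounded up, since the decay of the survivors
-- needs q large; with a denominator `2 ^ b` of at least τ + k, this raises q to at most (k + 2)/(τ
-- + k - t). Summed over vertices and phases, the fraction of failures is at most n (k + 2)^(k +
-- 1)/τ^k, and the 5 of the theorem comes from (k + 2)^(k + 1) ≤ 5 (2k)^k. The parameter c is a
-- Dedekind real, for which no exact ceiling can be computed. The protocol works with a natural
-- number C between c and c + 2 and with the least y such that y^k ≥ Cn. It uses 2ky colours where
-- 4k (cn)^(1/k) are allowed, and this factor 2 has to absorb both roundings. Passing from c to C
-- costs at most a factor 7/5 because c > 5.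

module Reals where
  open import Data.Integer as ℤ using (+_)
  import Data.Integer.Properties as ℤ
  open import Data.Nat as ℕ using (ℕ; zero; suc; NonZero)
  import Data.Nat.Coprimality as Coprimality
  import Data.Nat.Properties as ℕ
  open import Data.Rational hiding (NonZero; ceiling)
  open import Data.Rational.Properties
  open import Data.Rational.Unnormalised as ℚᵘ using (mkℚᵘ)
  import Data.Rational.Unnormalised.Properties as ℚᵘ
  open ℝ

  ^-*-distrib : ∀ x y k → (x ℕ.* y) ℕ.^ k ≡ x ℕ.^ k ℕ.* y ℕ.^ k
  ^-*-distrib x y zero    = refl
  ^-*-distrib x y (suc k) = trans (cong (x ℕ.* y ℕ.*_) (^-*-distrib x y k)) (ℕ.[m*n]*[o*p]≡[m*o]*[n*p] x y (x ℕ.^ k) (y ℕ.^ k))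

  ≤⇒≯ : ∀ {p q} → p ≤ q → ¬ q < p
  ≤⇒≯ p≤q q<p = <-irrefl refl (<-≤-trans q<p p≤q)

  fromℕ-mkℚ : ∀ n → fromℕ n ≡ mkℚ (+ n) 0 (Coprimality.sym (Coprimality.1-coprimeTo n))
  fromℕ-mkℚ n = normalize-coprime (Coprimality.sym (Coprimality.1-coprimeTo n))

  fromℕ-* : ∀ m n → fromℕ (m ℕ.* n) ≡ fromℕ m * fromℕ n
  fromℕ-* m n = sym (trans (cong₂ _*_ (fromℕ-mkℚ m) (fromℕ-mkℚ n)) (cong (_/ 1) (sym (ℤ.pos-* m n))))

  fromℕ-+ : ∀ m n → fromℕ (m ℕ.+ n) ≡ fromℕ m + fromℕ n
  fromℕ-+ m n = sym (trans (cong₂ _+_ (fromℕ-mkℚ m) (fromℕ-mkℚ n))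
    (cong (_/ 1) (cong₂ ℤ._+_ (ℤ.*-identityʳ (+ m)) (ℤ.*-identityʳ (+ n)))))

  fromℕ-^ : ∀ m k → fromℕ (m ℕ.^ k) ≡ fromℕ m ^ℚ k
  fromℕ-^ m zero    = refl
  fromℕ-^ m (suc k) = trans (fromℕ-* m (m ℕ.^ k)) (cong (fromℕ m *_) (fromℕ-^ m k))

  fromℕ-mono-≤ : ∀ {m n} → m ℕ.≤ n → fromℕ m ≤ fromℕ n
  fromℕ-mono-≤ {m} {n} m≤n = subst₂ _≤_ (sym (fromℕ-mkℚ m)) (sym (fromℕ-mkℚ n))
    (*≤* (ℤ.*-monoʳ-≤-nonNeg (+ 1) (ℤ.+≤+ m≤n)))

  fromℕ-mono-< : ∀ {m n} → m ℕ.< n → fromℕ m < fromℕ n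
  fromℕ-mono-< {m} {n} m<n = subst₂ _<_ (sym (fromℕ-mkℚ m)) (sym (fromℕ-mkℚ n))
    (*<* (ℤ.*-monoʳ-<-pos (+ 1) (ℤ.+<+ m<n)))

  fromℕ-cancel-≤ : ∀ {m n} → fromℕ m ≤ fromℕ n → m ℕ.≤ n
  fromℕ-cancel-≤ {m} {n} le with m ℕ.≤? n
  ... | yes m≤n = m≤n
  ... | no  m≰n = contradiction (fromℕ-mono-< (ℕ.≰⇒> m≰n)) (≤⇒≯ le)

  fromℕ-nonNeg : ∀ n → NonNegative (fromℕ n)
  fromℕ-nonNeg n = normalize-nonNeg n 1

  fromℕ-pos : ∀ n .{{_ : NonZero n}} → Positive (fromℕ n)
  fromℕ-pos n = normalize-pos n 1

  /-*-fromℕ : ∀ s t .{{_ : NonZero t}} → (+ s / t) * fromℕ t ≡ fromℕ s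
  /-*-fromℕ s (suc t) = toℚᵘ-injective (begin
    toℚᵘ ((+ s / suc t) * fromℕ (suc t))          ≈⟨ toℚᵘ-homo-* (+ s / suc t) (fromℕ (suc t)) ⟩
    toℚᵘ (+ s / suc t) ℚᵘ.* toℚᵘ (fromℕ (suc t))
      ≈⟨ ℚᵘ.*-cong (toℚᵘ-fromℚᵘ (mkℚᵘ (+ s) t)) (toℚᵘ-fromℚᵘ (mkℚᵘ (+ suc t) 0)) ⟩
    mkℚᵘ (+ s) t ℚᵘ.* mkℚᵘ (+ suc t) 0             ≈⟨ ℚᵘ.*≡* (trans (ℤ.*-identityʳ _) (cong (λ x → + s ℤ.* + x) (sym (ℕ.*-identityʳ (suc t))))) ⟩
    mkℚᵘ (+ s) 0                                   ≈⟨ toℚᵘ-fromℚᵘ (mkℚᵘ (+ s) 0) ⟨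
    toℚᵘ (fromℕ s)                                 ∎)
    where open import Relation.Binary.Reasoning.Setoid ℚᵘ.≃-setoid

  ≤fromℕ : ∀ q → ∃ λ N → q ≤ fromℕ N
  ≤fromℕ q@(mkℚ p d-1 c) = ℤ.∣ p ∣ , subst (q ≤_) (sym (fromℕ-mkℚ ℤ.∣ p ∣)) (*≤* (bound p))
    where
    bound : ∀ p → p ℤ.* + 1 ℤ.≤ + ℤ.∣ p ∣ ℤ.* + suc d-1
    bound (+ n)      = subst₂ ℤ._≤_ (ℤ.pos-* n 1) (ℤ.pos-* n (suc d-1)) (ℤ.+≤+ (ℕ.*-monoʳ-≤ n (ℕ.s≤s ℕ.z≤n)))
    bound ℤ.-[1+ n ] = ℤ.≤-trans (ℤ.≤-reflexive (ℤ.*-identityʳ _)) (subst (ℤ.-[1+ n ] ℤ.≤_) (ℤ.pos-* (suc n) (suc d-1)) ℤ.-≤+)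

  -- A Dedekind real is only located, so it is rounded up with an error of up to 2.
  ceiling : ∀ c → ∃ λ C → Upper c (fromℕ C) × (C ℕ.≤ 1 ⊎ ∃ λ B → C ≡ 2 ℕ.+ B × Lower c (fromℕ B))
  ceiling c = let u , cu = upper-inhabited c
                  N , u≤N = ≤fromℕ u
              in descend N (upper-closed c u≤N cu)
    where
    descend : ∀ N → Upper c (fromℕ N) → ∃ λ C → Upper c (fromℕ C) × (C ℕ.≤ 1 ⊎ ∃ λ B → C ≡ 2 ℕ.+ B × Lower c (fromℕ B))
    descend zero          up = 0 , up , inj₁ ℕ.z≤n
    descend (suc zero)    up = 1 , up , inj₁ ℕ.≤-refl
    descend (suc (suc B)) up =
      [ (λ lo → suc (suc B) , up , inj₂ (B , refl , lo)) , descend (suc B) ]′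
        (located c (fromℕ-mono-< (ℕ.n<1+n B)))

  -- The ratio 7/5 is (5 + 2)/5, the worst overshoot by 2 for c > 5. For B ≤ 5 the witness of c > 5
  -- serves, since 5C ≤ 35; otherwise `B` itself does, since 10 ≤ 2B.
  close-below : ∀ c → ⟦ fromℕ 5 ⟧ <ℝ c → ∀ {C} → 5 ℕ.< C → C ℕ.≤ 1 ⊎ (∃ λ B → C ≡ 2 ℕ.+ B × Lower c (fromℕ B)) →
    ∃ λ q → Lower c q × fromℕ 5 < q × fromℕ (5 ℕ.* C) ≤ fromℕ 7 * q
  close-below c _ 5<C (inj₁ C≤1) = contradiction 5<C (ℕ.≤⇒≯ (ℕ.≤-trans C≤1 (ℕ.s≤s ℕ.z≤n)))
  close-below c (q , 5<q , cq) 5<C (inj₂ (B , refl , lo)) = compare (B ℕ.≤? 5)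
    where
    open ≤-Reasoning
    compare : Dec (B ℕ.≤ 5) → ∃ λ q → Lower c q × fromℕ 5 < q × fromℕ (5 ℕ.* (2 ℕ.+ B)) ≤ fromℕ 7 * q
    compare (yes B≤5) = q , cq , 5<q , (begin
      fromℕ (5 ℕ.* (2 ℕ.+ B)) ≤⟨ fromℕ-mono-≤ (ℕ.*-monoʳ-≤ 5 (ℕ.+-monoʳ-≤ 2 B≤5)) ⟩
      fromℕ (7 ℕ.* 5)         ≡⟨ fromℕ-* 7 5 ⟩
      fromℕ 7 * fromℕ 5       ≤⟨ *-monoˡ-≤-nonNeg (fromℕ 7) (<⇒≤ 5<q) ⟩
      fromℕ 7 * q             ∎)
    compare (no B≰5) = fromℕ B , lo , fromℕ-mono-< (ℕ.≰⇒> B≰5) , (begin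
      fromℕ (5 ℕ.* (2 ℕ.+ B)) ≤⟨ fromℕ-mono-≤ 10+5B≤7B ⟩
      fromℕ (7 ℕ.* B)         ≡⟨ fromℕ-* 7 B ⟩
      fromℕ 7 * fromℕ B       ∎)
      where
      lhs : ∀ B → 5 ℕ.* (2 ℕ.+ B) ≡ 2 ℕ.* 5 ℕ.+ 5 ℕ.* B
      lhs = solve-∀
      rhs : ∀ B → 7 ℕ.* B ≡ 2 ℕ.* B ℕ.+ 5 ℕ.* B
      rhs = solve-∀
      10+5B≤7B : 5 ℕ.* (2 ℕ.+ B) ℕ.≤ 7 ℕ.* B
      10+5B≤7B = subst₂ ℕ._≤_ (sym (lhs B)) (sym (rhs B)) (ℕ.+-monoˡ-≤ (5 ℕ.* B) (ℕ.*-monoʳ-≤ 2 (ℕ.<⇒≤ (ℕ.≰⇒> B≰5))))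

  module Ceiling (c : ℝ) (5<c : ⟦ fromℕ 5 ⟧ <ℝ c) where

    C : ℕ
    C = proj₁ (ceiling c)

    5<C : 5 ℕ.< C
    5<C = ℕ.≰⇒> λ C≤5 → let q , 5<q , cq = 5<c in
      ≤⇒≯ (<⇒≤ (≤-<-trans (fromℕ-mono-≤ C≤5) 5<q)) (lower<upper c cq (proj₁ (proj₂ (ceiling c))))

    ceiling-close : ∃ λ q → Lower c q × fromℕ 5 < q × fromℕ (5 ℕ.* C) ≤ fromℕ 7 * q
    ceiling-close = close-below c 5<c 5<C (proj₂ (proj₂ (ceiling c)))

  rootFrom : ℕ → ℕ → ℕ → ℕ
  rootFrom k N zero    = zero
  rootFrom k N (suc w) with N ℕ.≤? w ℕ.^ k
  ... | yes _ = rootFrom k N w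
  ... | no  _ = suc w

  rootFrom-≥ : ∀ k N w → N ℕ.≤ w ℕ.^ k → N ℕ.≤ rootFrom k N w ℕ.^ k
  rootFrom-≥ k N zero    le = le
  rootFrom-≥ k N (suc w) le with N ℕ.≤? w ℕ.^ k
  ... | yes le′ = rootFrom-≥ k N w le′
  ... | no  _   = le

  rootFrom-least : ∀ k N w → rootFrom k N w ≡ 0 ⊎ ∃ λ x → rootFrom k N w ≡ suc x × x ℕ.^ k ℕ.< N
  rootFrom-least k N zero    = inj₁ refl
  rootFrom-least k N (suc w) with N ℕ.≤? w ℕ.^ k
  ... | yes _ = rootFrom-least k N w
  ... | no  ≰ = inj₂ (w , refl , ℕ.≰⇒> ≰)

  -- Since N ≤ N^k the search can start at N itself. It goes down until the next smaller value is
  -- too small, which gives minimality.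
  root↑ : ℕ → ℕ → ℕ
  root↑ k N = rootFrom k N N

  root↑-≥ : ∀ k N .{{_ : NonZero k}} → N ℕ.≤ root↑ k N ℕ.^ k
  root↑-≥ k N = rootFrom-≥ k N N (≤^ N k)
    where
    ≤^ : ∀ N k .{{_ : NonZero k}} → N ℕ.≤ N ℕ.^ k
    ≤^ zero    k       = ℕ.z≤n
    ≤^ (suc N) (suc k) = ℕ.m≤m*n (suc N) (suc N ℕ.^ k) {{ℕ.m^n≢0 (suc N) k}}

  root↑-least : ∀ k N .{{_ : NonZero k}} .{{_ : NonZero N}} → ∃ λ x → root↑ k N ≡ suc x × x ℕ.^ k ℕ.< N
  root↑-least k N with rootFrom-least k N N
  ... | inj₂ least = least
  root↑-least k@(suc _) N | inj₁ ≡0 =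
    contradiction (subst (λ y → N ℕ.≤ y ℕ.^ k) ≡0 (root↑-≥ k N)) (ℕ.<⇒≱ (ℕ.>-nonZero⁻¹ N))

  -- The partial sum 1/0! + 1/1! is already 2.
  ≤ln⇒2^≤ : ∀ {n} k → k ≤ln n → 2 ℕ.^ k ℕ.≤ n
  ≤ln⇒2^≤ k le = fromℕ-cancel-≤ (subst (_≤ _) (sym (fromℕ-^ 2 k)) (le 1))

  ^ℚ-distrib : ∀ p q k → (p * q) ^ℚ k ≡ p ^ℚ k * q ^ℚ k
  ^ℚ-distrib p q zero    = refl
  ^ℚ-distrib p q (suc k) = trans (cong (p * q *_) (^ℚ-distrib p q k)) (exchange p q (p ^ℚ k) (q ^ℚ k))
    where
    exchange : ∀ a b c d → a * b * (c * d) ≡ a * c * (b * d)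
    exchange a b c d = trans (*-assoc a b (c * d)) (trans
      (cong (a *_) (trans (sym (*-assoc b c d)) (trans (cong (_* d) (*-comm b c)) (*-assoc c b d))))
      (sym (*-assoc a c (b * d))))

  -- If x^k < N then (x + 1) / 2 is well below N^(1/k): for large x because
  -- x + 1 ≤ 4x/3, and for small x because N is large.
  half-root : ∀ k .{{_ : NonZero k}} x N → x ℕ.^ k ℕ.< N →
    suc x ℕ.^ k ℕ.≤ 2 ℕ.^ k ℕ.* 2 ℕ.^ k ⊎ 3 ℕ.* suc x ℕ.^ k ℕ.< 2 ℕ.* 2 ℕ.^ k ℕ.* N
  half-root k x N x^k<N with x ℕ.≤? 2
  ... | yes x≤2 = inj₁ (ℕ.≤-trans
    (ℕ.^-monoˡ-≤ k (ℕ.s≤s (ℕ.≤-trans x≤2 (ℕ.n≤1+n 2)))) (ℕ.≤-reflexive (^-*-distrib 2 2 k)))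
  ... | no  x≰2 = inj₂ (ℕ.≤-<-trans (go k) (ℕ.*-monoʳ-< (2 ℕ.* 2 ℕ.^ k) {{ℕ.m*n≢0 2 (2 ℕ.^ k) {{_}} {{ℕ.m^n≢0 2 k}}}} x^k<N))
    where
    x≥3 = ℕ.≰⇒> x≰2
    go : ∀ k .{{_ : NonZero k}} → 3 ℕ.* suc x ℕ.^ k ℕ.≤ 2 ℕ.* 2 ℕ.^ k ℕ.* x ℕ.^ k
    go 1 = subst₂ ℕ._≤_ (lhs x) (rhs x) (ℕ.+-monoˡ-≤ (3 ℕ.* x) x≥3)
      where
      lhs : ∀ x → 3 ℕ.+ 3 ℕ.* x ≡ 3 ℕ.* (suc x ℕ.* 1)
      lhs = solve-∀
      rhs : ∀ x → x ℕ.+ 3 ℕ.* x ≡ 4 ℕ.* (x ℕ.* 1)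
      rhs = solve-∀
    go (suc k@(suc _)) = begin
      3 ℕ.* (suc x ℕ.* suc x ℕ.^ k)                      ≡⟨ lhs (suc x) (suc x ℕ.^ k) ⟩
      suc x ℕ.* (3 ℕ.* suc x ℕ.^ k)                      ≤⟨ ℕ.*-mono-≤ 1+x≤2x (go k) ⟩
      2 ℕ.* x ℕ.* (2 ℕ.* 2 ℕ.^ k ℕ.* x ℕ.^ k)            ≡⟨ rhs x (2 ℕ.^ k) (x ℕ.^ k) ⟩
      2 ℕ.* (2 ℕ.* 2 ℕ.^ k) ℕ.* (x ℕ.* x ℕ.^ k)          ∎
      where
      open ℕ.≤-Reasoning
      lhs : ∀ y z → 3 ℕ.* (y ℕ.* z) ≡ y ℕ.* (3 ℕ.* z)
      lhs = solve-∀
      rhs : ∀ x P Y → 2 ℕ.* x ℕ.* (2 ℕ.* P ℕ.* Y) ≡ 2 ℕ.* (2 ℕ.* P) ℕ.* (x ℕ.* Y)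
      rhs = solve-∀
      1+x≤2x : suc x ℕ.≤ 2 ℕ.* x
      1+x≤2x = subst (suc x ℕ.≤_) (cong (x ℕ.+_) (sym (ℕ.+-identityʳ x))) (ℕ.+-monoˡ-≤ x (ℕ.≤-trans (ℕ.s≤s ℕ.z≤n) x≥3))

  -- To be used with P = 2^k and Y = y^k. For large y the losses of the two roundings multiply to
  -- 2/3 · 7/5 = 14/15 < 1; for small y the bound P · P ≤ P · n suffices.
  scaled-bound : ∀ {P n C Y q} .{{_ : NonZero P}} .{{_ : NonZero n}} → P ℕ.≤ n →
    fromℕ 5 < q → fromℕ (5 ℕ.* C) ≤ fromℕ 7 * q →
    Y ℕ.≤ P ℕ.* P ⊎ 3 ℕ.* Y ℕ.< 2 ℕ.* P ℕ.* (C ℕ.* n) →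
    fromℕ Y < fromℕ P * (fromℕ n * q)
  scaled-bound {P} {n} {C} {Y} {q} P≤n 5<q 5C≤7q = go
    where
    open ≤-Reasoning
    1<q : 1ℚ < q
    1<q = <-trans (fromℕ-mono-< {1} {5} (ℕ.s≤s (ℕ.s≤s ℕ.z≤n))) 5<q
    0≤q : 0ℚ ≤ q
    0≤q = <⇒≤ (≤-<-trans (fromℕ-mono-≤ (ℕ.z≤n {5})) 5<q)
    lhs : ∀ Y → 5 ℕ.* (3 ℕ.* Y) ≡ 15 ℕ.* Y
    lhs = solve-∀
    rhs : ∀ P C n → 5 ℕ.* (2 ℕ.* P ℕ.* (C ℕ.* n)) ≡ 2 ℕ.* (P ℕ.* n) ℕ.* (5 ℕ.* C)
    rhs = solve-∀
    fourteen : ∀ x → 14 ℕ.* x ≡ 2 ℕ.* x ℕ.* 7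
    fourteen = solve-∀
    go : Y ℕ.≤ P ℕ.* P ⊎ 3 ℕ.* Y ℕ.< 2 ℕ.* P ℕ.* (C ℕ.* n) → fromℕ Y < fromℕ P * (fromℕ n * q)
    go (inj₁ small) = begin-strict
      fromℕ Y                      ≤⟨ fromℕ-mono-≤ (ℕ.≤-trans small (ℕ.*-monoʳ-≤ P P≤n)) ⟩
      fromℕ (P ℕ.* n)              ≡⟨ *-identityʳ (fromℕ (P ℕ.* n)) ⟨
      fromℕ (P ℕ.* n) * 1ℚ         <⟨ *-monoʳ-<-pos (fromℕ (P ℕ.* n)) {{fromℕ-pos (P ℕ.* n) {{ℕ.m*n≢0 P n}}}} 1<q ⟩
      fromℕ (P ℕ.* n) * q          ≡⟨ trans (cong (_* q) (fromℕ-* P n)) (*-assoc (fromℕ P) (fromℕ n) q) ⟩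
      fromℕ P * (fromℕ n * q)      ∎
    go (inj₂ large) = *-cancelˡ-<-nonNeg (fromℕ 15) (begin-strict
      fromℕ 15 * fromℕ Y            ≡⟨ fromℕ-* 15 Y ⟨
      fromℕ (15 ℕ.* Y)                <⟨ fromℕ-mono-< (subst₂ ℕ._<_ (lhs Y) (rhs P C n) (ℕ.*-monoʳ-< 5 large)) ⟩
      fromℕ (2 ℕ.* (P ℕ.* n) ℕ.* (5 ℕ.* C))     ≡⟨ fromℕ-* (2 ℕ.* (P ℕ.* n)) (5 ℕ.* C) ⟩
      fromℕ (2 ℕ.* (P ℕ.* n)) * fromℕ (5 ℕ.* C) ≤⟨ *-monoˡ-≤-nonNeg (fromℕ (2 ℕ.* (P ℕ.* n))) {{fromℕ-nonNeg (2 ℕ.* (P ℕ.* n))}} 5C≤7q ⟩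
      fromℕ (2 ℕ.* (P ℕ.* n)) * (fromℕ 7 * q)   ≡⟨ *-assoc (fromℕ (2 ℕ.* (P ℕ.* n))) (fromℕ 7) q ⟨
      fromℕ (2 ℕ.* (P ℕ.* n)) * fromℕ 7 * q     ≡⟨ cong (_* q) (fromℕ-* (2 ℕ.* (P ℕ.* n)) 7) ⟨
      fromℕ (2 ℕ.* (P ℕ.* n) ℕ.* 7) * q         ≤⟨ *-monoʳ-≤-nonNeg q {{nonNegative 0≤q}} (fromℕ-mono-≤ (subst (ℕ._≤ 15 ℕ.* (P ℕ.* n)) (fourteen (P ℕ.* n)) (ℕ.*-monoˡ-≤ (P ℕ.* n) (ℕ.n≤1+n 14)))) ⟩
      fromℕ (15 ℕ.* (P ℕ.* n)) * q              ≡⟨ cong (_* q) (trans (fromℕ-* 15 (P ℕ.* n)) (cong (fromℕ 15 *_) (fromℕ-* P n))) ⟩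
      fromℕ 15 * (fromℕ P * fromℕ n) * q        ≡⟨ *-assoc (fromℕ 15) (fromℕ P * fromℕ n) q ⟩
      fromℕ 15 * (fromℕ P * fromℕ n * q)        ≡⟨ cong (fromℕ 15 *_) (*-assoc (fromℕ P) (fromℕ n) q) ⟩
      fromℕ 15 * (fromℕ P * (fromℕ n * q))      ∎)

  module RealRoot (n k : ℕ) .{{k≢0 : NonZero k}} (c : ℝ) (5<c : ⟦ fromℕ 5 ⟧ <ℝ c) (k≤ln : k ≤ln n) where
    open Ceiling c 5<c

    2^k≤n : 2 ℕ.^ k ℕ.≤ n
    2^k≤n = ≤ln⇒2^≤ k k≤ln

    instance
      n≢0 : NonZero n
      n≢0 = ℕ.>-nonZero (ℕ.≤-trans (ℕ.m^n>0 2 k) 2^k≤n)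
      C≢0 : NonZero C
      C≢0 = ℕ.>-nonZero (ℕ.≤-trans (ℕ.s≤s ℕ.z≤n) 5<C)
      Cn≢0 : NonZero (C ℕ.* n)
      Cn≢0 = ℕ.m*n≢0 C n

    y : ℕ
    y = root↑ k (C ℕ.* n)

    private
      P : ℕ
      P = 2 ℕ.^ k

      instance
        P≢0 : NonZero P
        P≢0 = ℕ.m^n≢0 2 k

    y^k< : ∃ λ q → Lower c q × fromℕ (y ℕ.^ k) < fromℕ P * (fromℕ n * q)
    y^k< =
      let q , cq , 5<q , 5C≤7q = ceiling-close
          x , y≡ , x^k<N = root↑-least k (C ℕ.* n)
      in q , cq , subst (λ y → fromℕ (y ℕ.^ k) < fromℕ P * (fromℕ n * q)) (sym y≡)
           (scaled-bound {P} {n} {C} {suc x ℕ.^ k} {q} 2^k≤n 5<q 5C≤7q (half-root k x (C ℕ.* n) x^k<N))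

    y/2<root : ∃ λ p → fromℕ 2 * p ≡ fromℕ y × Lower (root k (n · c)) p
    y/2<root = let q , cq , lt = y^k< in
      p , 2p≡y , inj₂ (q , cq , *-cancelˡ-<-nonNeg (fromℕ P) {{fromℕ-nonNeg P}} (subst (_< fromℕ P * (fromℕ n * q)) y^k≡ lt))
      where
      p : ℚ
      p = fromℕ y * ½
      2p≡y : fromℕ 2 * p ≡ fromℕ y
      2p≡y = trans (*-comm (fromℕ 2) p) (trans (*-assoc (fromℕ y) ½ (fromℕ 2)) (*-identityʳ (fromℕ y)))
      y^k≡ : fromℕ (y ℕ.^ k) ≡ fromℕ P * p ^ℚ k
      y^k≡ = trans (fromℕ-^ y k) (trans (cong (_^ℚ k) (sym 2p≡y)) (trans (^ℚ-distrib (fromℕ 2) p k) (cong (_* p ^ℚ k) (sym (fromℕ-^ 2 k)))))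

    ≤-multiple : ∀ m a → 2 ℕ.* m ℕ.≤ a ℕ.* y → ⟦ fromℕ m ⟧ ≤ℝ a · root k (n · c)
    ≤-multiple m a 2m≤ay {q} q<m = let p , 2p≡y , lo = y/2<root in
      p , lo , *-cancelˡ-<-nonNeg (fromℕ 2) (begin-strict
        fromℕ 2 * q              <⟨ *-monoʳ-<-pos (fromℕ 2) q<m ⟩
        fromℕ 2 * fromℕ m        ≡⟨ fromℕ-* 2 m ⟨
        fromℕ (2 ℕ.* m)          ≤⟨ fromℕ-mono-≤ 2m≤ay ⟩
        fromℕ (a ℕ.* y)          ≡⟨ fromℕ-* a y ⟩
        fromℕ a * fromℕ y        ≡⟨ cong (fromℕ a *_) 2p≡y ⟨
        fromℕ a * (fromℕ 2 * p)  ≡⟨ *-assoc (fromℕ a) (fromℕ 2) p ⟨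
        fromℕ a * fromℕ 2 * p    ≡⟨ cong (_* p) (*-comm (fromℕ a) (fromℕ 2)) ⟩
        fromℕ 2 * fromℕ a * p    ≡⟨ *-assoc (fromℕ 2) (fromℕ a) p ⟩
        fromℕ 2 * (fromℕ a * p)  ∎)
      where open ≤-Reasoning

  -- A rational q below 1 - 5/c comes with some p above 1/c such that 5p < 1 - q. As C exceeds c, Cp
  -- > 1, so f ≤ fCp ≤ 5tp: at most a fraction 5p of the outcomes fails.
  probability-bound : ∀ c (0<c : ⟦ 0ℚ ⟧ <ℝ c) C s f t .{{_ : NonZero t}} → Upper c (fromℕ C) →
    s ℕ.+ f ≡ t → f ℕ.* C ℕ.≤ 5 ℕ.* t → (1ℚ ⊖ 5 · recip c 0<c) ≤ℝ ⟦ + s / t ⟧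
  probability-bound c 0<c C s f t c<C s+f≡t fC≤5t {q} (p , (l , cl , 0<l , 1<lp) , 5p<1-q) = begin-strict
    q                            ≡⟨ add-sub q (fromℕ 5 * p) ⟩
    q + fromℕ 5 * p - fromℕ 5 * p <⟨ +-monoˡ-< (- (fromℕ 5 * p)) q+5p<1 ⟩
    1ℚ - fromℕ 5 * p             ≤⟨ +-monoˡ-≤ (- (fromℕ 5 * p)) 1≤S+5p ⟩
    S + fromℕ 5 * p - fromℕ 5 * p ≡⟨ add-sub S (fromℕ 5 * p) ⟨
    S                            ∎
    where
    open ≤-Reasoning
    S : ℚ
    S = + s / t
    add-sub : ∀ a b → a ≡ a + b - b
    add-sub a b = sym (trans (+-assoc a b (- b)) (trans (cong (_+_ a) (+-inverseʳ b)) (+-identityʳ a)))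
    q+5p<1 : q + fromℕ 5 * p < 1ℚ
    q+5p<1 = begin-strict
      q + fromℕ 5 * p     <⟨ +-monoʳ-< q 5p<1-q ⟩
      q + (1ℚ - q)        ≡⟨ +-comm q (1ℚ - q) ⟩
      1ℚ - q + q          ≡⟨ +-assoc 1ℚ (- q) q ⟩
      1ℚ + (- q + q)      ≡⟨ cong (_+_ 1ℚ) (+-inverseˡ q) ⟩
      1ℚ + 0ℚ             ≡⟨⟩
      1ℚ                  ∎
    0<p : 0ℚ < p
    0<p = *-cancelˡ-<-nonNeg l {{nonNegative (<⇒≤ 0<l)}} (begin-strict
      l * 0ℚ   ≡⟨ *-zeroʳ l ⟩
      0ℚ       <⟨ positive⁻¹ 1ℚ ⟩
      1ℚ       <⟨ 1<lp ⟩
      l * p    ∎)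
    1≤Cp : 1ℚ ≤ fromℕ C * p
    1≤Cp = <⇒≤ (<-trans 1<lp (*-monoˡ-<-pos p {{positive 0<p}} (lower<upper c cl c<C)))
    total : ℚ
    total = fromℕ t
    f≤5Tp : fromℕ f ≤ total * (fromℕ 5 * p)
    f≤5Tp = begin
      fromℕ f                    ≡⟨ *-identityʳ (fromℕ f) ⟨
      fromℕ f * 1ℚ               ≤⟨ *-monoˡ-≤-nonNeg (fromℕ f) {{fromℕ-nonNeg f}} 1≤Cp ⟩
      fromℕ f * (fromℕ C * p)    ≡⟨ *-assoc (fromℕ f) (fromℕ C) p ⟨
      fromℕ f * fromℕ C * p      ≡⟨ cong (_* p) (fromℕ-* f C) ⟨
      fromℕ (f ℕ.* C) * p        ≤⟨ *-monoʳ-≤-nonNeg p {{nonNegative (<⇒≤ 0<p)}} (fromℕ-mono-≤ fC≤5t) ⟩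
      fromℕ (5 ℕ.* t) * p        ≡⟨ cong (_* p) (trans (cong fromℕ (ℕ.*-comm 5 t)) (fromℕ-* t 5)) ⟩
      total * fromℕ 5 * p            ≡⟨ *-assoc total (fromℕ 5) p ⟩
      total * (fromℕ 5 * p)          ∎
    1≤S+5p : 1ℚ ≤ S + fromℕ 5 * p
    1≤S+5p = *-cancelˡ-≤-pos total {{fromℕ-pos t}} (begin
      total * 1ℚ                          ≡⟨ *-identityʳ total ⟩
      total                               ≡⟨ cong fromℕ s+f≡t ⟨
      fromℕ (s ℕ.+ f)                 ≡⟨ fromℕ-+ s f ⟩
      fromℕ s + fromℕ f               ≤⟨ +-monoʳ-≤ (fromℕ s) f≤5Tp ⟩
      fromℕ s + total * (fromℕ 5 * p)     ≡⟨ cong (_+ total * (fromℕ 5 * p)) (trans (sym (/-*-fromℕ s t)) (*-comm S total)) ⟩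
      total * S + total * (fromℕ 5 * p)       ≡⟨ *-distribˡ-+ total S (fromℕ 5 * p) ⟨
      total * (S + fromℕ 5 * p)           ∎)

open Reals

open import Data.Nat
open import Data.Nat.DivMod
open import Data.Nat.Induction using (<-wellFounded)
open import Data.Nat.Logarithm using (⌈log₂_⌉; ⌈log₂⌈n/2⌉⌉≡⌈log₂n⌉∸1; ⌈log₂⌉-mono-≤)
open import Data.Nat.Properties
open import Data.Rational using (1ℚ)

-- Sums over uniform samples

private
  variable
    A B A′ : Set

∑ : List A → (A → ℕ) → ℕ
∑ []       f = 0
∑ (x ∷ xs) f = f x + ∑ xs f

∑-cong : ∀ (xs : List A) {f g} → (∀ x → f x ≡ g x) → ∑ xs f ≡ ∑ xs g
∑-cong []       eq = refl
∑-cong (x ∷ xs) eq = cong₂ _+_ (eq x) (∑-cong xs eq)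

∑-mono : ∀ (xs : List A) {f g} → (∀ x → f x ≤ g x) → ∑ xs f ≤ ∑ xs g
∑-mono []       le = z≤n
∑-mono (x ∷ xs) le = +-mono-≤ (le x) (∑-mono xs le)

∑-const : ∀ (xs : List A) c → ∑ xs (const c) ≡ length xs * c
∑-const []       c = refl
∑-const (x ∷ xs) c = cong (c +_) (∑-const xs c)

∑-+ : ∀ (xs : List A) f g → ∑ xs (λ x → f x + g x) ≡ ∑ xs f + ∑ xs g
∑-+ []       f g = refl
∑-+ (x ∷ xs) f g = trans (cong (f x + g x +_) (∑-+ xs f g)) (+-exchange (f x) (g x) _ _)
  where
  +-exchange : ∀ a b c d → a + b + (c + d) ≡ a + c + (b + d)
  +-exchange = solve-∀

∑-* : ∀ c (xs : List A) f → c * ∑ xs f ≡ ∑ xs (λ x → c * f x)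
∑-* c []       f = *-zeroʳ c
∑-* c (x ∷ xs) f = trans (*-distribˡ-+ c (f x) _) (cong (c * f x +_) (∑-* c xs f))

∑-swap : ∀ (xs : List A) (ys : List B) (f : A → B → ℕ) →
  ∑ xs (λ x → ∑ ys (f x)) ≡ ∑ ys (λ y → ∑ xs (λ x → f x y))
∑-swap []       ys f = sym (trans (∑-const ys 0) (*-zeroʳ (length ys)))
∑-swap (x ∷ xs) ys f = trans (cong (∑ ys (f x) +_) (∑-swap xs ys f)) (sym (∑-+ ys (f x) _))

∑-++ : ∀ (xs ys : List A) f → ∑ (xs ++ ys) f ≡ ∑ xs f + ∑ ys f
∑-++ []       ys f = refl
∑-++ (x ∷ xs) ys f = trans (cong (f x +_) (∑-++ xs ys f)) (sym (+-assoc (f x) _ _))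

∑-map : ∀ (g : A → B) xs f → ∑ (List.map g xs) f ≡ ∑ xs (f ∘ g)
∑-map g []       f = refl
∑-map g (x ∷ xs) f = cong (f (g x) +_) (∑-map g xs f)

∑-product : ∀ (g : A → B → A′) xs ys f →
  ∑ (cartesianProductWith g xs ys) f ≡ ∑ xs (λ x → ∑ ys (λ y → f (g x y)))
∑-product g []       ys f = refl
∑-product g (x ∷ xs) ys f =
  trans (∑-++ (List.map (g x) ys) _ f) (cong₂ _+_ (∑-map (g x) ys f) (∑-product g xs ys f))

∑-∈ : ∀ {xs : List A} {x} f → x ∈ xs → f x ≤ ∑ xs f
∑-∈ f (here refl) = m≤m+n _ _
∑-∈ f (there x∈xs) = ≤-trans (∑-∈ f x∈xs) (m≤n+m _ _)

∑≡0 : ∀ (xs : List A) {f} → (∀ x → f x ≡ 0) → ∑ xs f ≡ 0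
∑≡0 xs f≡0 = trans (∑-cong xs f≡0) (trans (∑-const xs 0) (*-zeroʳ (length xs)))

∑-tabulate≡0 : ∀ {n} (g : Fin n → A) f → (∀ i → f (g i) ≡ 0) → ∑ (List.tabulate g) f ≡ 0
∑-tabulate≡0 {n = zero}  g f f≡0 = refl
∑-tabulate≡0 {n = suc n} g f f≡0 = cong₂ _+_ (f≡0 zero) (∑-tabulate≡0 (g ∘ suc) f (f≡0 ∘ suc))

∑-tabulate≤1 : ∀ {n} (g : Fin n → A) f → (∀ x → f x ≤ 1) →
  (∀ i j → f (g i) ≢ 0 → f (g j) ≢ 0 → i ≡ j) → ∑ (List.tabulate g) f ≤ 1
∑-tabulate≤1 {n = zero}  g f f≤1 unique = z≤n
∑-tabulate≤1 {n = suc n} g f f≤1 unique with f (g zero) in eq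
... | zero = ∑-tabulate≤1 (g ∘ suc) f f≤1
  λ i j i≢0 j≢0 → Fin.suc-injective (unique (suc i) (suc j) i≢0 j≢0)
... | suc m = subst (λ s → suc m + s ≤ 1) (sym (∑-tabulate≡0 (g ∘ suc) f rest≡0))
                (subst (_≤ 1) (trans eq (sym (+-identityʳ _))) (f≤1 (g zero)))
  where
  rest≡0 : ∀ j → f (g (suc j)) ≡ 0
  rest≡0 j with f (g (suc j)) in eq′
  ... | zero  = refl
  ... | suc _ with () ← unique zero (suc j) (λ e → 1+n≢0 (trans (sym eq) e))
                                            (λ e → 1+n≢0 (trans (sym eq′) e))

-- g sends the uniform distribution on xs to the one on ys.
Pushes : (A → B) → List A → List B → Set
Pushes g xs ys = ∀ f → ∑ xs (f ∘ g) ≡ ∑ ys f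

map-pushes : ∀ {g : A → B} {xs ys} n → Pushes g xs ys →
  Pushes (Vec.map g) (allVecs xs n) (allVecs ys n)
map-pushes zero p f = refl
map-pushes {g = g} {xs} {ys} (suc n) p f = begin
  ∑ (allVecs xs (suc n)) (f ∘ Vec.map g)
    ≡⟨ ∑-product _∷_ xs (allVecs xs n) _ ⟩
  ∑ xs (λ x → ∑ (allVecs xs n) (λ v → f (g x ∷ Vec.map g v)))
    ≡⟨ ∑-cong xs (λ x → map-pushes n p (λ v → f (g x ∷ v))) ⟩
  ∑ xs (λ x → ∑ (allVecs ys n) (λ v → f (g x ∷ v)))
    ≡⟨ p (λ y → ∑ (allVecs ys n) (λ v → f (y ∷ v))) ⟩
  ∑ ys (λ y → ∑ (allVecs ys n) (λ v → f (y ∷ v)))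
    ≡⟨ ∑-product _∷_ ys (allVecs ys n) f ⟨
  ∑ (allVecs ys (suc n)) f ∎
  where open ≡-Reasoning

chunks : ∀ m {w} → Vec A (m * w) → Vec (Vec A w) m
chunks zero        z = []
chunks (suc m) {w} z = take w z ∷ chunks m (drop w z)

∑-allVecs-+ : ∀ (xs : List A) w {l} (f : Vec A w → Vec A l → ℕ) →
  ∑ (allVecs xs (w + l)) (λ z → f (take w z) (drop w z)) ≡
  ∑ (allVecs xs w) (λ u → ∑ (allVecs xs l) (f u))
∑-allVecs-+ xs zero    f = sym (+-identityʳ _)
∑-allVecs-+ xs (suc w) {l} f = begin
  ∑ (allVecs xs (suc w + l)) (λ z → f (take (suc w) z) (drop (suc w) z))
    ≡⟨ ∑-product _∷_ xs (allVecs xs (w + l)) _ ⟩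
  ∑ xs (λ x → ∑ (allVecs xs (w + l)) (λ z → f (x ∷ take w z) (drop w z)))
    ≡⟨ ∑-cong xs (λ x → ∑-allVecs-+ xs w (λ u → f (x ∷ u))) ⟩
  ∑ xs (λ x → ∑ (allVecs xs w) (λ u → ∑ (allVecs xs l) (f (x ∷ u))))
    ≡⟨ ∑-product _∷_ xs (allVecs xs w) _ ⟨
  ∑ (allVecs xs (suc w)) (λ u → ∑ (allVecs xs l) (f u)) ∎
  where open ≡-Reasoning

chunks-pushes : ∀ (xs : List A) m w → Pushes (chunks m {w}) (allVecs xs (m * w)) (allVecs (allVecs xs w) m)
chunks-pushes xs zero    w f = refl
chunks-pushes xs (suc m) w f = begin
  ∑ (allVecs xs (w + m * w)) (λ z → f (take w z ∷ chunks m (drop w z)))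
    ≡⟨ ∑-allVecs-+ xs w (λ u z → f (u ∷ chunks m z)) ⟩
  ∑ (allVecs xs w) (λ u → ∑ (allVecs xs (m * w)) (λ z → f (u ∷ chunks m z)))
    ≡⟨ ∑-cong (allVecs xs w) (λ u → chunks-pushes xs m w (λ v → f (u ∷ v))) ⟩
  ∑ (allVecs xs w) (λ u → ∑ (allVecs (allVecs xs w) m) (λ v → f (u ∷ v)))
    ≡⟨ ∑-product _∷_ (allVecs xs w) (allVecs (allVecs xs w) m) f ⟨
  ∑ (allVecs (allVecs xs w) (suc m)) f ∎
  where open ≡-Reasoning

-- Replacing part of a uniform sample by fresh randomness ys keeps it uniform.
Resamples : (A → B → A) → List A → List B → Set
Resamples T xs ys = ∀ f → ∑ xs (λ x → ∑ ys (λ y → f (T x y))) ≡ length ys * ∑ xs f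

const-resamples : ∀ (xs : List A) → Resamples (λ _ y → y) xs xs
const-resamples xs f = ∑-const xs (∑ xs f)

-- The other coordinates can be summed separately, so resampling lifts from an entry to the whole
-- vector. Applied twice, it reaches a single block of a single vertex.
updateAt-resamples : ∀ {T : A → B → A} {xs ys} {n} (v : Fin n) → Resamples T xs ys →
  Resamples (λ ω y → updateAt ω v (λ x → T x y)) (allVecs xs n) ys
updateAt-resamples {T = T} {xs} {ys} {suc n} zero res f = begin
  ∑ (allVecs xs (suc n)) (λ ω → ∑ ys (λ y → f (updateAt ω zero (λ x → T x y))))
    ≡⟨ ∑-product _∷_ xs (allVecs xs n) _ ⟩
  ∑ xs (λ x → ∑ (allVecs xs n) (λ ω → ∑ ys (λ y → f (T x y ∷ ω))))
    ≡⟨ ∑-cong xs (λ x → ∑-swap (allVecs xs n) ys _) ⟩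
  ∑ xs (λ x → ∑ ys (λ y → ∑ (allVecs xs n) (λ ω → f (T x y ∷ ω))))
    ≡⟨ res (λ x → ∑ (allVecs xs n) (λ ω → f (x ∷ ω))) ⟩
  length ys * ∑ xs (λ x → ∑ (allVecs xs n) (λ ω → f (x ∷ ω)))
    ≡⟨ cong (length ys *_) (∑-product _∷_ xs (allVecs xs n) f) ⟨
  length ys * ∑ (allVecs xs (suc n)) f ∎
  where open ≡-Reasoning
updateAt-resamples {T = T} {xs} {ys} {suc n} (suc v) res f = begin
  ∑ (allVecs xs (suc n)) (λ ω → ∑ ys (λ y → f (updateAt ω (suc v) (λ x → T x y))))
    ≡⟨ ∑-product _∷_ xs (allVecs xs n) _ ⟩
  ∑ xs (λ x → ∑ (allVecs xs n) (λ ω → ∑ ys (λ y → f (x ∷ updateAt ω v (λ x → T x y)))))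
    ≡⟨ ∑-cong xs (λ x → updateAt-resamples {T = T} {xs} {ys} v res (λ ω → f (x ∷ ω))) ⟩
  ∑ xs (λ x → length ys * ∑ (allVecs xs n) (λ ω → f (x ∷ ω)))
    ≡⟨ ∑-* (length ys) xs _ ⟨
  length ys * ∑ xs (λ x → ∑ (allVecs xs n) (λ ω → f (x ∷ ω)))
    ≡⟨ cong (length ys *_) (∑-product _∷_ xs (allVecs xs n) f) ⟨
  length ys * ∑ (allVecs xs (suc n)) f ∎
  where open ≡-Reasoning

-- Bernoulli trials and binary numbers

𝟙 : Bool → ℕ
𝟙 true  = 1
𝟙 false = 0

𝟙≤1 : ∀ b → 𝟙 b ≤ 1
𝟙≤1 true  = ≤-refl
𝟙≤1 false = z≤n

coin : List Bool
coin = false ∷ true ∷ []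

val : List Bool → ℕ
val []       = 0
val (d ∷ ds) = 𝟙 d + 2 * val ds

odd : ℕ → Bool
odd zero    = false
odd (suc x) = not (odd x)

bits : ℕ → ℕ → List Bool
bits zero    x = []
bits (suc b) x = odd x ∷ bits b ⌊ x /2⌋

length-bits : ∀ b x → length (bits b x) ≡ b
length-bits zero    x = refl
length-bits (suc b) x = cong suc (length-bits b ⌊ x /2⌋)

odd+half : ∀ x → 𝟙 (odd x) + 2 * ⌊ x /2⌋ ≡ x
odd+half zero          = refl
odd+half (suc zero)    = refl
odd+half (suc (suc x)) with odd x | odd+half x
... | true  | eq = trans (lemma 1 ⌊ x /2⌋) (cong (2 +_) eq)
  where
  lemma : ∀ a h → a + 2 * suc h ≡ 2 + (a + 2 * h)
  lemma = solve-∀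
... | false | eq = trans (lemma ⌊ x /2⌋) (cong (2 +_) eq)
  where
  lemma : ∀ h → 2 * suc h ≡ 2 + 2 * h
  lemma = solve-∀

val-bits : ∀ b {x} → x < 2 ^ b → val (bits b x) ≡ x
val-bits zero    {x} x<1 = sym (n<1⇒n≡0 x<1)
val-bits (suc b) {x} x<  = trans (cong (λ h → 𝟙 (odd x) + 2 * h) (val-bits b half<)) (odd+half x)
  where
  half< : ⌊ x /2⌋ < 2 ^ b
  half< = *-cancelˡ-< 2 _ _ (≤-<-trans (subst (2 * ⌊ x /2⌋ ≤_) (odd+half x) (m≤n+m _ (𝟙 (odd x)))) x<)

hit : ∀ {b} → ℕ → Vec Bool b → Bool
hit θ x = val (Vec.toList x) <ᵇ θ

<ᵇ-⌈/2⌉ : ∀ v θ → (2 * v <ᵇ θ) ≡ (v <ᵇ ⌈ θ /2⌉)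
<ᵇ-⌈/2⌉ zero    zero          = refl
<ᵇ-⌈/2⌉ zero    (suc θ)       = refl
<ᵇ-⌈/2⌉ (suc v) zero          = refl
<ᵇ-⌈/2⌉ (suc v) (suc zero)    = refl
<ᵇ-⌈/2⌉ (suc v) (suc (suc θ)) rewrite +-suc v (v + 0) = <ᵇ-⌈/2⌉ v θ

<ᵇ-⌊/2⌋ : ∀ v θ → (1 + 2 * v <ᵇ θ) ≡ (v <ᵇ ⌊ θ /2⌋)
<ᵇ-⌊/2⌋ v zero    = refl
<ᵇ-⌊/2⌋ v (suc θ) = <ᵇ-⌈/2⌉ v θ

-- The lowest digit comes first, so the head of the vector splits the numbers below θ into ⌈θ/2⌉
-- even and ⌊θ/2⌋ odd ones.
count-hit : ∀ b {θ} → θ ≤ 2 ^ b → ∑ (allVecs coin b) (𝟙 ∘ hit θ) ≡ θ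
count-hit zero {zero}        le = refl
count-hit zero {suc zero}    le = refl
count-hit zero {suc (suc θ)} (s≤s ())
count-hit (suc b) {θ} le = begin
  ∑ (allVecs coin (suc b)) (𝟙 ∘ hit θ)
    ≡⟨ ∑-product _∷_ coin (allVecs coin b) _ ⟩
  ∑ (allVecs coin b) (λ x → 𝟙 (2 * val (Vec.toList x) <ᵇ θ)) +
  (∑ (allVecs coin b) (λ x → 𝟙 (1 + 2 * val (Vec.toList x) <ᵇ θ)) + 0)
    ≡⟨ cong₂ _+_ (∑-cong (allVecs coin b) (λ x → cong 𝟙 (<ᵇ-⌈/2⌉ (val (Vec.toList x)) θ)))
                 (trans (+-identityʳ _) (∑-cong (allVecs coin b) (λ x → cong 𝟙 (<ᵇ-⌊/2⌋ (val (Vec.toList x)) θ)))) ⟩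
  ∑ (allVecs coin b) (𝟙 ∘ hit ⌈ θ /2⌉) + ∑ (allVecs coin b) (𝟙 ∘ hit ⌊ θ /2⌋)
    ≡⟨ cong₂ _+_ (count-hit b up≤) (count-hit b (≤-trans (⌊n/2⌋≤⌈n/2⌉ θ) up≤)) ⟩
  ⌈ θ /2⌉ + ⌊ θ /2⌋
    ≡⟨ +-comm ⌈ θ /2⌉ ⌊ θ /2⌋ ⟩
  ⌊ θ /2⌋ + ⌈ θ /2⌉
    ≡⟨ ⌊n/2⌋+⌈n/2⌉≡n θ ⟩
  θ ∎
  where
  open ≡-Reasoning
  up≤ : ⌈ θ /2⌉ ≤ 2 ^ b
  up≤ = subst (⌈ θ /2⌉ ≤_) (trans (cong (λ m → ⌈ 2 ^ b + m /2⌉) (+-identityʳ (2 ^ b))) (sym (n≡⌈n+n/2⌉ (2 ^ b))))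
              (⌈n/2⌉-mono le)

-- The number of leading successes, a truncated geometric variable.
geo : ∀ {b K} → ℕ → Vec (Vec Bool b) K → ℕ
geo θ []       = 0
geo θ (x ∷ xs) = if hit θ x then suc (geo θ xs) else 0

blocks : ∀ b K → List (Vec (Vec Bool b) K)
blocks b K = allVecs (allVecs coin b) K

length-blocks : ∀ b K → length (blocks b K) ≡ (2 ^ b) ^ K
length-blocks b K = trans (length-allVecs (allVecs coin b) K) (cong (_^ K) (length-allVecs coin b))

-- The event `f` for a radius with one success taken away; the success taken away is the margin by
-- which a winner has to lead.
shift : (ℕ → Bool) → ℕ → Bool
shift f zero    = false
shift f (suc r) = f r

geo-≤ : ∀ {b K} θ (x : Vec (Vec Bool b) K) → geo θ x ≤ K
geo-≤ θ []       = z≤n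
geo-≤ θ (x ∷ xs) with hit θ x
... | true  = s≤s (geo-≤ θ xs)
... | false = z≤n

module Geometric (b θ : ℕ) (θ≤ : θ ≤ 2 ^ b) where

  ∑-geo-suc : ∀ K f → f 0 ≡ 0 →
    ∑ (blocks b (suc K)) (f ∘ geo θ) ≡ θ * ∑ (blocks b K) (f ∘ suc ∘ geo θ)
  ∑-geo-suc K f f0≡0 = begin
    ∑ (blocks b (suc K)) (f ∘ geo θ)
      ≡⟨ ∑-product _∷_ (allVecs coin b) (blocks b K) _ ⟩
    ∑ (allVecs coin b) (λ x → ∑ (blocks b K) (λ xs → f (if hit θ x then suc (geo θ xs) else 0)))
      ≡⟨ ∑-cong (allVecs coin b) (λ x → first (hit θ x)) ⟩
    ∑ (allVecs coin b) (λ x → R * 𝟙 (hit θ x))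
      ≡⟨ ∑-* R (allVecs coin b) (𝟙 ∘ hit θ) ⟨
    R * ∑ (allVecs coin b) (𝟙 ∘ hit θ)
      ≡⟨ cong (R *_) (count-hit b θ≤) ⟩
    R * θ
      ≡⟨ *-comm R θ ⟩
    θ * R ∎
    where
    open ≡-Reasoning
    R = ∑ (blocks b K) (f ∘ suc ∘ geo θ)
    first : ∀ h → ∑ (blocks b K) (λ xs → f (if h then suc (geo θ xs) else 0)) ≡ R * 𝟙 h
    first true  = sym (*-identityʳ R)
    first false = trans (∑≡0 (blocks b K) (λ _ → f0≡0)) (sym (*-zeroʳ R))

  ∑-geo-max : ∀ K → ∑ (blocks b K) (λ x → 𝟙 (geo θ x ≡ᵇ K)) ≡ θ ^ K
  ∑-geo-max zero    = refl
  ∑-geo-max (suc K) = trans (∑-geo-suc K (λ r → 𝟙 (r ≡ᵇ suc K)) refl) (cong (θ *_) (∑-geo-max K))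

  -- Memorylessness: a monotone event of the radius r still holds for r − 1
  -- with conditional probability at least θ / 2ᵇ.
  memoryless : ∀ K (f : ℕ → Bool) → (∀ r → f r ≡ true → f (suc r) ≡ true) → f (suc K) ≡ f K →
    θ * ∑ (blocks b (suc K)) (𝟙 ∘ f ∘ geo θ) ≤ 2 ^ b * ∑ (blocks b (suc K)) (𝟙 ∘ shift f ∘ geo θ)
  memoryless K f mono cap with f 0 in f0
  -- A monotone event that holds at 0 always holds, and its shift only says that the first trial
  -- succeeds.
  ... | true = begin
    θ * ∑ (blocks b (suc K)) (𝟙 ∘ f ∘ geo θ)
      ≡⟨ cong (θ *_) (count-all (suc K)) ⟩
    θ * (2 ^ b * (2 ^ b) ^ K)
      ≡⟨ lemma θ (2 ^ b) ((2 ^ b) ^ K) ⟩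
    2 ^ b * (θ * (2 ^ b) ^ K)
      ≡⟨ cong (λ s → 2 ^ b * (θ * s)) (count-all K) ⟨
    2 ^ b * (θ * ∑ (blocks b K) (𝟙 ∘ f ∘ geo θ))
      ≡⟨ cong (2 ^ b *_) (∑-geo-suc K (𝟙 ∘ shift f) refl) ⟨
    2 ^ b * ∑ (blocks b (suc K)) (𝟙 ∘ shift f ∘ geo θ) ∎
    where
    open ≤-Reasoning
    lemma : ∀ x y z → x * (y * z) ≡ y * (x * z)
    lemma = solve-∀
    f≡true : ∀ r → f r ≡ true
    f≡true zero    = f0
    f≡true (suc r) = mono r (f≡true r)
    count-all : ∀ K → ∑ (blocks b K) (𝟙 ∘ f ∘ geo θ) ≡ (2 ^ b) ^ K
    count-all K = trans (∑-cong (blocks b K) (λ x → cong 𝟙 (f≡true (geo θ x))))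
      (trans (∑-const (blocks b K) 1) (trans (*-identityʳ _) (length-blocks b K)))
  -- Here `cap` makes `f` false at 1 as well. An event that requires the maximal radius would have
  -- an empty shift.
  memoryless zero f mono cap | false = subst (_≤ 2 ^ b * ∑ (blocks b 1) (𝟙 ∘ shift f ∘ geo θ)) (sym ≡0) z≤n
    where
    zero≡ : θ * (𝟙 (f 1) + 0) ≡ 0
    zero≡ rewrite cap | f0 = *-zeroʳ θ
    ≡0 : θ * ∑ (blocks b 1) (𝟙 ∘ f ∘ geo θ) ≡ 0
    ≡0 = trans (cong (θ *_) (trans (∑-geo-suc zero (𝟙 ∘ f) (cong 𝟙 f0)) zero≡)) (*-zeroʳ θ)
  -- Both events now require a first success; removing it leaves `f ∘ suc` and one trial fewer.
  memoryless (suc K) f mono cap | false = begin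
    θ * ∑ (blocks b (suc (suc K))) (𝟙 ∘ f ∘ geo θ)
      ≡⟨ cong (θ *_) (∑-geo-suc (suc K) (𝟙 ∘ f) (cong 𝟙 f0)) ⟩
    θ * (θ * ∑ (blocks b (suc K)) (𝟙 ∘ f ∘ suc ∘ geo θ))
      ≤⟨ *-monoʳ-≤ θ (memoryless K (f ∘ suc) (mono ∘ suc) cap) ⟩
    θ * (2 ^ b * ∑ (blocks b (suc K)) (𝟙 ∘ shift (f ∘ suc) ∘ geo θ))
      ≡⟨ cong (λ s → θ * (2 ^ b * s)) (∑-cong (blocks b (suc K)) (λ x → cong 𝟙 (shift-suc (geo θ x)))) ⟩
    θ * (2 ^ b * ∑ (blocks b (suc K)) (𝟙 ∘ f ∘ geo θ))
      ≡⟨ lemma θ (2 ^ b) _ ⟩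
    2 ^ b * (θ * ∑ (blocks b (suc K)) (𝟙 ∘ f ∘ geo θ))
      ≡⟨ cong (2 ^ b *_) (∑-geo-suc (suc K) (𝟙 ∘ shift f) refl) ⟨
    2 ^ b * ∑ (blocks b (suc (suc K))) (𝟙 ∘ shift f ∘ geo θ) ∎
    where
    open ≤-Reasoning
    lemma : ∀ x y z → x * (y * z) ≡ y * (x * z)
    lemma = solve-∀
    shift-suc : ∀ r → shift (f ∘ suc) r ≡ f r
    shift-suc zero    = sym f0
    shift-suc (suc r) = refl

-- Walks and single phases

least : ∀ {P : ℕ → Set} → Decidable P → ∀ {ℓ} → P ℓ →
  ∃ λ d → P d × (∀ m → P m → d ≤ m) × d ≤ ℓ
least {P} P? {ℓ} Pℓ = go ℓ (<-wellFounded ℓ) Pℓ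
  where
  go : ∀ ℓ → Acc _<_ ℓ → P ℓ → ∃ λ d → P d × (∀ m → P m → d ≤ m) × d ≤ ℓ
  go ℓ (acc rec) Pℓ with anyUpTo? P? ℓ
  ... | yes (m , m<ℓ , Pm) = let d , Pd , min , d≤m = go m (rec m<ℓ) Pm in
    d , Pd , min , ≤-trans d≤m (<⇒≤ m<ℓ)
  ... | no none = ℓ , Pℓ , (λ m Pm → ≮⇒≥ (λ m<ℓ → none (m , m<ℓ , Pm))) , ≤-refl

maxF : ∀ {n} → (Fin n → ℕ) → ℕ
maxF {zero}  f = 0
maxF {suc n} f = f zero ⊔ maxF (f ∘ suc)

maxF-cong : ∀ {n} {f g : Fin n → ℕ} → (∀ i → f i ≡ g i) → maxF f ≡ maxF g
maxF-cong {zero}  eq = refl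
maxF-cong {suc n} eq = cong₂ _⊔_ (eq zero) (maxF-cong (eq ∘ suc))

≤maxF : ∀ {n} (f : Fin n → ℕ) i → f i ≤ maxF f
≤maxF f zero    = m≤m⊔n _ _
≤maxF f (suc i) = ≤-trans (≤maxF (f ∘ suc) i) (m≤n⊔m (f zero) _)

maxF-attained : ∀ {n} (f : Fin n → ℕ) → maxF f ≡ 0 ⊎ ∃ λ i → maxF f ≡ f i
maxF-attained {zero}  f = inj₁ refl
maxF-attained {suc n} f with ⊔-sel (f zero) (maxF (f ∘ suc))
... | inj₁ eq = inj₂ (zero , eq)
... | inj₂ eq with maxF-attained (f ∘ suc)
...   | inj₁ ≡0       = inj₁ (trans eq ≡0)
...   | inj₂ (i , ≡i) = inj₂ (suc i , trans eq ≡i)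

module _ {n : ℕ} {G : Graph n} {S : Fin n → Set} where

  walk? : Decidable S → ∀ u v ℓ → Dec (Walk G S u v ℓ)
  walk? S? u v zero = map′ (λ { (refl , s) → here s }) (λ { (here s) → refl , s }) (u Fin.≟ v ×-dec S? v)
  walk? S? u v (suc ℓ) = map′ (λ { (s , w , a , p) → step s a p }) (λ { (step s a p) → s , _ , a , p })
    (S? u ×-dec Fin.any? (λ w → (adj G u w Bool.≟ true) ×-dec walk? S? w v ℓ))

  walk-start : ∀ {u v ℓ} → Walk G S u v ℓ → S u
  walk-start (here s)     = s
  walk-start (step s _ _) = s

  walk-++ : ∀ {u v w ℓ m} → Walk G S u v ℓ → Walk G S v w m → Walk G S u w (ℓ + m)
  walk-++ (here _)     q = q
  walk-++ (step s a p) q = step s a (walk-++ p q)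

  adj-sym : ∀ {u v} → Adj G u v → Adj G v u
  adj-sym {u} {v} a = trans (symmetric G v u) a

  walk-reverse : ∀ {u v ℓ} → Walk G S u v ℓ → Walk G S v u ℓ
  walk-reverse (here s) = here s
  walk-reverse {ℓ = suc ℓ} (step s a p) =
    subst (Walk G S _ _) (+-comm ℓ 1)
      (walk-++ (walk-reverse p) (step (walk-start p) (adj-sym a) (here s)))

  distance : Decidable S → ∀ {u v ℓ} → Walk G S u v ℓ → ∃ λ d → IsDistance G S u v d × d ≤ ℓ
  distance S? {u} {v} p with least (walk? S? u v) p
  ... | d , q , min , d≤ℓ = d , (q , min) , d≤ℓ

≡ᵇ-true : ∀ {m n} → m ≡ n → (m ≡ᵇ n) ≡ true
≡ᵇ-true {m} refl = Equivalence.to Bool.T-≡ (≡⇒≡ᵇ m m refl)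

≡ᵇ-true⁻¹ : ∀ {m n} → (m ≡ᵇ n) ≡ true → m ≡ n
≡ᵇ-true⁻¹ {m} {n} eq = ≡ᵇ⇒≡ m n (subst T (sym eq) _)

∧-true : ∀ {a b} → a ∧ b ≡ true → a ≡ true × b ≡ true
∧-true {true} eq = refl , eq

-- One phase: vertices without a label (0) are active; u emits its identity at
-- time e u, and the identities spread by one edge per round.
module Phase {n : ℕ} (adjacent : Fin n → Fin n → Bool) (L e : Fin n → ℕ) where

  active : Fin n → Bool
  active v = L v ≡ᵇ 0

  own : (Fin n → ℕ) → ℕ → Fin n → ℕ
  own wt i y = if e y ≤ᵇ i then wt y else 0

  flood : (Fin n → ℕ) → ℕ → Fin n → ℕ
  flood wt zero    y = if active y then own wt 0 y else 0
  flood wt (suc i) y =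
    if active y
    then own wt (suc i) y ⊔ (flood wt i y ⊔ maxF (λ z → if adjacent y z then flood wt i z else 0))
    else 0

  hi lo : ℕ → Fin n → ℕ
  hi = flood (suc ∘ toℕ)
  lo = flood (λ u → n ∸ toℕ u)

  -- hi and lo are 1 + the largest and n − the smallest identity received (0 if
  -- there is none), so their sum is n + 1 exactly if a single one has arrived.
  joins : ℕ → Fin n → Bool
  joins i y = (hi i y + lo i y ≡ᵇ suc n) ∧ (hi (suc i) y ≡ᵇ hi i y)

  -- The label is never 0 when τ is positive, and modulo τ it leaves the phase, which becomes the
  -- colour. If a vertex joins at several times, `Join-unique` shows that the values agree.
  label : (t τ : ℕ) → ℕ → Fin n → ℕ
  label t τ zero    y = L y
  label t τ (suc i) y = if joins i y then t + hi i y * τ else label t τ i y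

module PhaseProperties {n : ℕ} (G : Graph n) (L e : Fin n → ℕ) where
  open Phase (adj G) L e

  Active : Fin n → Set
  Active v = active v ≡ true

  active? : Decidable Active
  active? v = active v Bool.≟ true

  -- The emission time `s` is left free in order to ask what would have happened with another radius
  -- of u.
  Near : ℕ → ℕ → Fin n → Fin n → Set
  Near s i y u = ∃ λ d → Walk G Active y u d × s + d ≤ i

  near? : ∀ s i y u → Dec (Near s i y u)
  near? s i y u = map′ (λ { (d , _ , p) → d , p }) (λ { (d , p , le) → d , s≤s (≤-trans (m≤n+m d s) le) , p , le })
    (anyUpTo? (λ d → walk? active? y u d ×-dec (s + d ≤? i)) (suc i))

  near-mono : ∀ {s i j y u} → i ≤ j → Near s i y u → Near s j y u
  near-mono i≤j (d , p , le) = d , p , ≤-trans le i≤j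

  near-anti : ∀ {s r i y u} → r ≤ s → Near s i y u → Near r i y u
  near-anti r≤s (d , p , le) = d , p , ≤-trans (+-monoˡ-≤ d r≤s) le

  near-pred : ∀ {s i y u} → Near (suc s) (suc i) y u → Near s i y u
  near-pred (d , p , s≤s le) = d , p , le

  near-later : ∀ {s i j y u} → i < j → Near s i y u → Near (suc s) j y u
  near-later i<j (d , p , le) = d , p , ≤-<-trans le i<j

  near-step : ∀ {s i y z u} → Active y → Adj G y z → Near s i z u → Near s (suc i) y u
  near-step {s} ay a (d , p , le) = suc d , step ay a p , ≤-trans (≤-reflexive (+-suc s d)) (s≤s le)

  reached : ℕ → Fin n → Fin n → Set
  reached i y u = Near (e u) i y u

  module _ (wt : Fin n → ℕ) where

    own-≤ : ∀ {i y} → e y ≤ i → own wt i y ≡ wt y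
    own-≤ {i} {y} le rewrite Equivalence.to Bool.T-≡ (≤⇒≤ᵇ le) = refl
    
    own-attained : ∀ i y → own wt i y ≡ 0 ⊎ (e y ≤ i × own wt i y ≡ wt y)
    own-attained i y with e y ≤ᵇ i in eq
    ... | true  = inj₂ (≤ᵇ⇒≤ (e y) i (subst T (sym eq) _) , refl)
    ... | false = inj₁ refl

    wt≤flood : ∀ i {y u} → reached i y u → wt u ≤ flood wt i y
    wt≤flood zero {y} (zero , here ay , le) rewrite ay = 
      ≤-reflexive (sym (own-≤ (≤-trans (m≤m+n (e y) 0) le)))
    wt≤flood zero {u = u} (suc d , _ , le) with () ← ≤-trans (≤-reflexive (sym (+-suc (e u) d))) le
    wt≤flood (suc i) {y} (zero , here ay , le) rewrite ay =
      ≤-trans (≤-reflexive (sym (own-≤ (≤-trans (m≤m+n (e y) 0) le)))) (m≤m⊔n (own wt (suc i) y) _)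
    wt≤flood (suc i) {y} {u} (suc d , step {v = z} ay a p , le) rewrite ay = begin
      wt u
        ≤⟨ wt≤flood i (d , p , s≤s⁻¹ (≤-trans (≤-reflexive (sym (+-suc (e u) d))) le)) ⟩
      flood wt i z
        ≡⟨ cong (λ b → if b then flood wt i z else 0) a ⟨
      (if adj G y z then flood wt i z else 0)
        ≤⟨ ≤maxF (λ z → if adj G y z then flood wt i z else 0) z ⟩
      maxF (λ z → if adj G y z then flood wt i z else 0)
        ≤⟨ m≤n⊔m (flood wt i y) _ ⟩
      flood wt i y ⊔ maxF (λ z → if adj G y z then flood wt i z else 0)
        ≤⟨ m≤n⊔m (own wt (suc i) y) _ ⟩
      own wt (suc i) y ⊔ (flood wt i y ⊔ maxF (λ z → if adj G y z then flood wt i z else 0)) ∎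
      where open ≤-Reasoning

    flood-attained : ∀ i y → flood wt i y ≡ 0 ⊎ ∃ λ u → reached i y u × flood wt i y ≡ wt u
    flood-attained zero y with active y in ay
    ... | false = inj₁ refl
    ... | true with own-attained 0 y
    ...   | inj₁ ≡0        = inj₁ ≡0
    ...   | inj₂ (le , ≡y) = inj₂ (y , (0 , here ay , ≤-trans (≤-reflexive (+-identityʳ (e y))) le) , ≡y)
    flood-attained (suc i) y with active y in ay
    ... | false = inj₁ refl
    ... | true with ⊔-sel (own wt (suc i) y) (flood wt i y ⊔ maxF (λ z → if adj G y z then flood wt i z else 0))
    ...   | inj₁ eq with own-attained (suc i) y
    ...     | inj₁ ≡0        = inj₁ (trans eq ≡0)
    ...     | inj₂ (le , ≡y) = inj₂ (y , (0 , here ay , ≤-trans (≤-reflexive (+-identityʳ (e y))) le) , trans eq ≡y)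
    flood-attained (suc i) y | true | inj₂ eq
      with ⊔-sel (flood wt i y) (maxF (λ z → if adj G y z then flood wt i z else 0))
    ...   | inj₁ eq′ with flood-attained i y
    ...     | inj₁ ≡0            = inj₁ (trans eq (trans eq′ ≡0))
    ...     | inj₂ (u , near , ≡u) = inj₂ (u , near-mono (n≤1+n i) near , trans eq (trans eq′ ≡u))
    flood-attained (suc i) y | true | inj₂ eq | inj₂ eq′
      with maxF-attained (λ z → if adj G y z then flood wt i z else 0)
    ...   | inj₁ ≡0 = inj₁ (trans eq (trans eq′ ≡0))
    ...   | inj₂ (z , ≡z) with adj G y z in a
    ...     | false = inj₁ (trans eq (trans eq′ ≡z))
    ...     | true with flood-attained i z
    ...       | inj₁ ≡0              = inj₁ (trans eq (trans eq′ (trans ≡z ≡0)))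
    ...       | inj₂ (u , near , ≡u) = inj₂ (u , near-step ay a near , trans eq (trans eq′ (trans ≡z ≡u)))

    flood-≤ : ∀ {b} → (∀ u → wt u ≤ b) → ∀ i y → flood wt i y ≤ b
    flood-≤ wt≤b i y with flood-attained i y
    ... | inj₁ ≡0           = ≤-trans (≤-reflexive ≡0) z≤n
    ... | inj₂ (u , _ , ≡u) = ≤-trans (≤-reflexive ≡u) (wt≤b u)

  Join : Fin n → Fin n → ℕ → Set
  Join y v i = reached i y v × (∀ u → reached i y u → u ≡ v) × (∀ u → reached (suc i) y u → toℕ u ≤ toℕ v)

  -- If v is the largest arrival, then `hi` is v + 1, and the sum n + 1 forces `lo` to be n - v, so
  -- v is also the smallest. Without arrivals the sum would be at most n.
  joins⇒Join : ∀ i y → joins i y ≡ true → ∃ λ v → hi i y ≡ suc (toℕ v) × Join y v i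
  joins⇒Join i y eq with ∧-true {hi i y + lo i y ≡ᵇ suc n} eq
  ... | sum≡ , next≡
    with flood-attained (suc ∘ toℕ) i y | flood-attained (λ u → n ∸ toℕ u) i y
       | ≡ᵇ-true⁻¹ {hi i y + lo i y} sum≡ | ≡ᵇ-true⁻¹ {hi (suc i) y} next≡
  ... | inj₁ hi≡0 | _ | sum | _ = contradiction
    (subst (λ h → h + lo i y ≤ n) (sym hi≡0) (flood-≤ (λ u → n ∸ toℕ u) (λ u → m∸n≤m n (toℕ u)) i y))
    (<⇒≱ (≤-reflexive (sym sum)))
  ... | inj₂ (v , near , hi≡) | att | sum | next = v , hi≡ , near , only , latest
    where
    lo≡ : lo i y ≡ n ∸ toℕ v
    lo≡ = +-cancelˡ-≡ (suc (toℕ v)) _ _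
      (trans (cong (_+ lo i y) (sym hi≡)) (trans sum (cong suc (sym (m+[n∸m]≡n (<⇒≤ (Fin.toℕ<n v)))))))
    only : ∀ u → reached i y u → u ≡ v
    only u near-u = Fin.toℕ-injective (≤-antisym
      (s≤s⁻¹ (subst (suc (toℕ u) ≤_) hi≡ (wt≤flood (suc ∘ toℕ) i near-u)))
      (∸-cancelʳ-≤ (<⇒≤ (Fin.toℕ<n v)) (subst (n ∸ toℕ u ≤_) lo≡ (wt≤flood (λ u → n ∸ toℕ u) i near-u))))
    latest : ∀ u → reached (suc i) y u → toℕ u ≤ toℕ v
    latest u near-u = s≤s⁻¹ (subst (suc (toℕ u) ≤_) (trans next hi≡) (wt≤flood (suc ∘ toℕ) (suc i) near-u))

  flood-max : ∀ wt {i y v} → reached i y v → (∀ u → reached i y u → wt u ≤ wt v) → flood wt i y ≡ wt v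
  flood-max wt {i} {y} near max with flood-attained wt i y
  ... | inj₁ ≡0 = trans ≡0 (sym (n≤0⇒n≡0 (subst (_ ≤_) ≡0 (wt≤flood wt i near))))
  ... | inj₂ (u , near-u , ≡u) = ≤-antisym (subst (_≤ _) (sym ≡u) (max u near-u)) (wt≤flood wt i near)

  Join⇒joins : ∀ {i y v} → Join y v i → joins i y ≡ true
  Join⇒joins {i} {y} {v} (near , only , latest) = cong₂ _∧_
    (≡ᵇ-true (trans (cong₂ _+_ hi≡ lo≡) (cong suc (m+[n∸m]≡n (<⇒≤ (Fin.toℕ<n v))))))
    (≡ᵇ-true (trans (flood-max (suc ∘ toℕ) (near-mono (n≤1+n i) near) (λ u r → s≤s (latest u r))) (sym hi≡)))
    where
    hi≡ = flood-max (suc ∘ toℕ) {i} {y} near (λ u r → ≤-reflexive (cong (suc ∘ toℕ) (only u r)))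
    lo≡ = flood-max (λ u → n ∸ toℕ u) {i} {y} near (λ u r → ≤-reflexive (cong (λ w → n ∸ toℕ w) (only u r)))

  -- Arrivals are never forgotten, so the identity joined earlier is still present at the later
  -- time, when only one is.
  Join-unique : ∀ {y v v′ i i′} → Join y v i → Join y v′ i′ → v ≡ v′
  Join-unique {i = i} {i′} (near , only , _) (near′ , only′ , _) with ≤-total i i′
  ... | inj₁ i≤i′ = only′ _ (near-mono i≤i′ near)
  ... | inj₂ i′≤i = sym (only _ (near-mono i′≤i near′))

  Join-active : ∀ {y v i} → Join y v i → Active y
  Join-active ((_ , p , _) , _) = walk-start p

  -- Whatever reaches z arrives at its neighbour y one round later, so every rival at z would be a
  -- rival at y.
  Join-step : ∀ {y z v i} → Active y → Adj G y z → Near (e v) i z v → Join y v (suc i) → Join z v i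
  Join-step ay a near (_ , only , latest) =
    near , (λ u r → only u (near-step ay a r)) , (λ u r → latest u (near-step ay a r))

  -- The identity of the earlier joiner crosses the edge in time to be the only one at the later
  -- joiner. If both join at the same time, each identity crosses one round later, and the condition
  -- on that round allows neither to be the larger one.
  Join-adj : ∀ {y z v u i j} → Adj G y z → Join y v i → Join z u j → v ≡ u
  Join-adj {i = i} {j} a J@(near , only , latest) J′@(near′ , only′ , latest′) with <-cmp i j
  ... | tri< i<j _ _ = only′ _ (near-mono i<j (near-step (Join-active J′) (adj-sym {G = G} {Active} a) near))
  ... | tri> _ _ j<i = sym (only _ (near-mono j<i (near-step (Join-active J) a near′)))
  ... | tri≈ _ refl _ = Fin.toℕ-injective (≤-antisym
    (latest′ _ (near-step (Join-active J′) (adj-sym {G = G} {Active} a) near))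
    (latest _ (near-step (Join-active J) a near′)))

  module _ (t τ : ℕ) where

    code : Fin n → ℕ
    code v = t + suc (toℕ v) * τ

    label-cases : ∀ k y → (label t τ k y ≡ L y × (∀ i → i < k → joins i y ≡ false)) ⊎
                          ∃ λ v → ∃ λ i → i < k × Join y v i × label t τ k y ≡ code v
    label-cases zero y = inj₁ (refl , λ _ ())
    label-cases (suc k) y with joins k y in eq
    ... | true = let v , hi≡ , J = joins⇒Join k y eq in
      inj₂ (v , k , ≤-refl , J , cong (λ h → t + h * τ) hi≡)
    ... | false with label-cases k y
    ...   | inj₂ (v , i , i<k , J , ≡v) = inj₂ (v , i , m<n⇒m<1+n i<k , J , ≡v)
    ...   | inj₁ (≡L , none) = inj₁ (≡L , λ i i<1+k → none′ i (m≤n⇒m<n∨m≡n (s≤s⁻¹ i<1+k)))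
      where
      none′ : ∀ i → i < k ⊎ i ≡ k → joins i y ≡ false
      none′ i (inj₁ i<k)  = none i i<k
      none′ i (inj₂ refl) = eq

    Join⇒label : ∀ {k y v i} → i < k → Join y v i → label t τ k y ≡ code v
    Join⇒label {k} {y} {v} {i} i<k J with label-cases k y
    ... | inj₁ (_ , none) with () ← trans (sym (Join⇒joins J)) (none i i<k)
    ... | inj₂ (v′ , _ , _ , J′ , ≡v′) = trans ≡v′ (cong code (Join-unique J′ J))

    -- The margin by which y joins v grows by one with every step towards v.
    Join-walk : ∀ {k i y v d} → i < k → Walk G Active y v d → e v + d ≤ i → Join y v i →
      Walk G (λ z → label t τ k z ≡ code v) y v d
    Join-walk i<k (here _) le J = here (Join⇒label i<k J)
    Join-walk {i = zero} {v = v} {suc d} _ (step _ _ _) le J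
      with () ← ≤-trans (≤-reflexive (sym (+-suc (e v) d))) le
    Join-walk {i = suc i} {v = v} {suc d} i<k (step ay a p) le J = step (Join⇒label i<k J) a
      (Join-walk (<-trans (n<1+n i) i<k) p le′ (Join-step ay a (d , p , le′) J))
      where le′ = s≤s⁻¹ (≤-trans (≤-reflexive (sym (+-suc (e v) d))) le)

  -- Were v to emit its identity at time s instead of e v, it would be the first
  -- one to arrive at y, larger identities winning ties.
  Wins : ℕ → Fin n → ℕ → Fin n → Set
  Wins k v s y = ∃ λ i → i < suc k × Near s i y v ×
    (∀ u → u ≢ v → ¬ Near (suc (e u)) i y u × (reached i y u → toℕ u < toℕ v))

  abstract
    wins? : ∀ k v s y → Dec (Wins k v s y)
    wins? k v s y = anyUpTo? (λ i → near? s i y v ×-dec Fin.all? (λ u →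
      ¬? (u Fin.≟ v) →-dec (¬? (near? (suc (e u)) i y u) ×-dec (near? (e u) i y u →-dec (toℕ u <? toℕ v))))) (suc k)

  wins-anti : ∀ {k v s r y} → r ≤ s → Wins k v s y → Wins k v r y
  wins-anti r≤s (i , i≤k , near , others) = i , i≤k , near-anti r≤s near , others

  -- The winner is the largest identity present at the first time of any arrival. The emission of y
  -- itself shows that this time is at most k.
  wins-exists : ∀ {k y} → Active y → e y ≤ k → ∃ λ v → Wins k v (e v) y
  wins-exists {k} {y} ay le
    with least {λ i → ∃ λ u → reached i y u} (λ i → Fin.any? (λ u → near? (e u) i y u))
               {k} (y , 0 , here ay , ≤-trans (≤-reflexive (+-identityʳ (e y))) le)
  ... | i , (u₀ , near₀) , min , i≤k with flood-attained (suc ∘ toℕ) i y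
  ...   | inj₁ ≡0 with () ← ≤-trans (wt≤flood (suc ∘ toℕ) i near₀) (≤-reflexive ≡0)
  ...   | inj₂ (v , near , hi≡) = v , i , s≤s i≤k , near , λ u u≢v →
    (λ near-u → not-before i min u near-u) ,
    (λ r → ≤∧≢⇒< (s≤s⁻¹ (subst (suc (toℕ u) ≤_) hi≡ (wt≤flood (suc ∘ toℕ) i r))) (u≢v ∘ Fin.toℕ-injective))
    where
    not-before : ∀ i → (∀ m → (∃ λ u → reached m y u) → i ≤ m) → ∀ u → ¬ Near (suc (e u)) i y u
    not-before zero    min u (d , p , ())
    not-before (suc i) min u near = 1+n≰n (min i (u , near-pred near))

  wins-unique : ∀ {k y v v′} → Wins k v (e v) y → Wins k v′ (e v′) y → v ≡ v′
  wins-unique {v = v} {v′} (i , _ , near , others) (i′ , _ , near′ , others′) with v Fin.≟ v′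
  ... | yes v≡v′ = v≡v′
  ... | no  v≢v′ with <-cmp i i′
  ...   | tri< i<i′ _ _ = contradiction (near-later i<i′ near) (proj₁ (others′ v v≢v′))
  ...   | tri> _ _ i′<i = contradiction (near-later i′<i near′) (proj₁ (others v′ (v≢v′ ∘ sym)))
  ...   | tri≈ _ refl _ = contradiction (proj₂ (others′ v v≢v′) near)
    (<⇒≯ (proj₂ (others v′ (v≢v′ ∘ sym)) near′))

  -- The spare unit brings v to y at time i, while every rival takes until i + 1 at least and those
  -- that arrive then are smaller. So `Wins` must admit arrival times up to k although joins happen
  -- before k.
  wins⇒Join : ∀ {k y v} → Wins k v (suc (e v)) y → ∃ λ i → i < k × Join y v i
  wins⇒Join (zero , _ , (d , p , ()) , _)
  wins⇒Join {y = y} {v} (suc i , i<k , near , others) = i , s≤s⁻¹ i<k , near-pred near , only , latest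
    where
    only : ∀ u → reached i y u → u ≡ v
    only u (d , p , le) with u Fin.≟ v
    ... | yes u≡v = u≡v
    ... | no  u≢v = contradiction (d , p , s≤s le) (proj₁ (others u u≢v))
    latest : ∀ u → reached (suc i) y u → toℕ u ≤ toℕ v
    latest u r with u Fin.≟ v
    ... | yes refl = ≤-refl
    ... | no  u≢v  = <⇒≤ (proj₂ (others u u≢v) r)

  wins⇒active : ∀ {k v s y} → Wins k v s y → Active v
  wins⇒active (_ , _ , (_ , p , _) , _) = walk-start (walk-reverse p)

-- The protocol

n≤2^⌈log₂n⌉ : ∀ n → n ≤ 2 ^ ⌈log₂ n ⌉
n≤2^⌈log₂n⌉ n = go n (<-wellFounded n)
  where
  go : ∀ n → Acc _<_ n → n ≤ 2 ^ ⌈log₂ n ⌉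
  go zero          _         = z≤n
  go (suc zero)    _         = ≤-refl
  go n@(suc (suc m)) (acc rec) = begin
    n                               ≡⟨ ⌊n/2⌋+⌈n/2⌉≡n n ⟨
    ⌊ n /2⌋ + ⌈ n /2⌉               ≤⟨ +-mono-≤ (⌊n/2⌋≤⌈n/2⌉ n) ≤-refl ⟩
    ⌈ n /2⌉ + ⌈ n /2⌉               ≡⟨ cong (⌈ n /2⌉ +_) (+-identityʳ _) ⟨
    2 * ⌈ n /2⌉                     ≤⟨ *-monoʳ-≤ 2 (go ⌈ n /2⌉ (rec (⌈n/2⌉<n m))) ⟩
    2 * 2 ^ ⌈log₂ ⌈ n /2⌉ ⌉         ≡⟨ cong (λ l → 2 * 2 ^ l) (⌈log₂⌈n/2⌉⌉≡⌈log₂n⌉∸1 n) ⟩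
    2 * 2 ^ (⌈log₂ n ⌉ ∸ 1)         ≡⟨ cong (2 ^_) (m+[n∸m]≡n (⌈log₂⌉-mono-≤ {2} {n} (s≤s (s≤s z≤n)))) ⟩
    2 ^ ⌈log₂ n ⌉                   ∎
    where open ≤-Reasoning

-- The default is reached: the last round of the protocol already sets up phase τ, for which there
-- is no block.
nth : ∀ {A : Set} {n} → A → ℕ → Vec A n → A
nth d t       []       = d
nth d zero    (x ∷ xs) = x
nth d (suc t) (x ∷ xs) = nth d t xs

walk-map : ∀ {n} {G : Graph n} {S S′ : Fin n → Set} {u v ℓ} →
  (∀ {w} → S w → S′ w) → Walk G S u v ℓ → Walk G S′ u v ℓ
walk-map f (here s)     = here (f s)
walk-map f (step s a p) = step (f s) a (walk-map f p)

-- τ phases of k rounds each; in phase t every radius is a run of at most k + 1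
-- Bernoulli trials of b coins with success probability θ t / 2ᵇ.
module Parameters (n k τ b : ℕ) (θ : ℕ → ℕ) where

  Block : Set
  Block = Vec (Vec Bool b) (suc k)

  noBlock : Block
  noBlock = Vec.replicate _ (Vec.replicate _ false)

  coinsPerVertex : ℕ
  coinsPerVertex = τ * (suc k * b)

  tosses : Vec Bool coinsPerVertex → Vec Block τ
  tosses z = Vec.map (chunks (suc k)) (chunks τ z)

  radius : ℕ → Vec Block τ → ℕ
  radius t Z = geo (θ t) (nth noBlock t Z)

  -- One bit more than ⌈log₂ n⌉, because n itself is among the numbers sent and may be a power of
  -- two.
  numberLength : ℕ
  numberLength = suc (wordLength n)

  -- A vertex that has joined goes on relaying until the phase ends, so `before` decides whether it
  -- is active and `after` collects the decisions.
  record State : Set where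
    constructor mkState
    field
      me      : Fin n
      myCoins : Vec Bool coinsPerVertex
      phase   : ℕ
      time    : ℕ
      delay   : ℕ
      before  : ℕ
      after   : ℕ
      high    : ℕ
      low     : ℕ

  begin-phase : Fin n → Vec Bool coinsPerVertex → ℕ → ℕ → ℕ → State
  begin-phase v z t d l = mkState v z t 0 d l l
    (if l ≡ᵇ 0 then (if d ≤ᵇ 0 then suc (toℕ v) else 0) else 0)
    (if l ≡ᵇ 0 then (if d ≤ᵇ 0 then n ∸ toℕ v else 0) else 0)

  -- The decision for time i has to wait for the arrivals of time i + 1. Time 0 of the next phase
  -- needs no messages, so it shares a state with the end of the current one and k rounds per phase
  -- suffice.
  advance : State → ℕ → ℕ → State
  advance (mkState v z t i d l l′ h w) H W =
    if suc i ≡ᵇ k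
    then begin-phase v z (suc t) (k ∸ radius (suc t) (tosses z)) new
    else mkState v z t (suc i) d l new h′ w′
    where
    h′ w′ new : ℕ
    h′ = if l ≡ᵇ 0 then (if d ≤ᵇ suc i then suc (toℕ v) else 0) ⊔ (h ⊔ H) else 0
    w′ = if l ≡ᵇ 0 then (if d ≤ᵇ suc i then n ∸ toℕ v else 0) ⊔ (w ⊔ W) else 0
    new = if (h + w ≡ᵇ suc n) ∧ (h′ ≡ᵇ h) then t + h * τ else l′

  encode : ℕ → ℕ → Message
  encode h w = bits numberLength h ++ bits numberLength w

  high-of low-of : Maybe Message → ℕ
  high-of = maybe (λ m → val (List.take numberLength m)) 0
  low-of  = maybe (λ m → val (List.drop numberLength m)) 0

  protocol : Protocol n
  protocol = record
    { State   = State
    ; coins   = coinsPerVertex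
    ; rounds  = τ * k
    ; init    = λ v _ z → begin-phase v z 0 (k ∸ radius 0 (tosses z)) 0
    ; send    = λ s _ → encode (State.high s) (State.low s)
    ; receive = λ s m → advance s (maxF (high-of ∘ m)) (maxF (low-of ∘ m))
    ; output  = State.after
    }

  length-encode : ∀ h w → length (encode h w) ≡ numberLength + numberLength
  length-encode h w = trans (List.length-++ (bits numberLength h))
    (cong₂ _+_ (length-bits numberLength h) (length-bits numberLength w))

  n<2^numberLength : n < 2 ^ numberLength
  n<2^numberLength = begin-strict
    n                          ≤⟨ n≤2^⌈log₂n⌉ n ⟩
    2 ^ wordLength n           <⟨ m<m+n _ (m^n>0 2 (wordLength n)) ⟩
    2 ^ wordLength n + 2 ^ wordLength n ≡⟨ cong (2 ^ wordLength n +_) (+-identityʳ _) ⟨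
    2 ^ numberLength           ∎
    where open ≤-Reasoning

  take-drop-++ : ∀ l (xs ys : List Bool) → length xs ≡ l →
    List.take l (xs ++ ys) ≡ xs × List.drop l (xs ++ ys) ≡ ys
  take-drop-++ zero    []       ys refl = refl , refl
  take-drop-++ (suc l) (x ∷ xs) ys eq =
    let t , d = take-drop-++ l xs ys (suc-injective eq) in cong (x ∷_) t , d

  decode-high : ∀ {h} w → h ≤ n → high-of (just (encode h w)) ≡ h
  decode-high {h} w h≤n = trans
    (cong val (proj₁ (take-drop-++ numberLength (bits numberLength h) (bits numberLength w) (length-bits numberLength h))))
    (val-bits numberLength (≤-<-trans h≤n n<2^numberLength))

  decode-low : ∀ h {w} → w ≤ n → low-of (just (encode h w)) ≡ w
  decode-low h {w} w≤n = trans
    (cong val (proj₂ (take-drop-++ numberLength (bits numberLength h) (bits numberLength w) (length-bits numberLength h))))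
    (val-bits numberLength (≤-<-trans w≤n n<2^numberLength))

  module Run (G : Graph n) where

    delays : Vec ℕ n → Fin n → ℕ
    delays r u = k ∸ lookup r u

    -- The labels before phase t, for radii r s drawn in phase s.
    labels : (ℕ → Vec ℕ n) → ℕ → Fin n → ℕ
    labels r zero    v = 0
    labels r (suc t) v = Phase.label (adj G) (labels r t) (delays (r t)) t τ k v

    radii : Vec (Vec Block τ) n → ℕ → Vec ℕ n
    radii Ω t = Vec.map (radius t) Ω

    module _ (ω : Vec (Vec Bool coinsPerVertex) n) where
      open Execution protocol G using (state; clustering)

      private
        r : ℕ → Vec ℕ n
        r = radii (Vec.map tosses ω)

        delay≡ : ∀ t v → k ∸ radius t (tosses (lookup ω v)) ≡ delays (r t) v
        delay≡ t v = cong (k ∸_) (sym (trans (Vec.lookup-map v (radius t) (Vec.map tosses ω))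
                                             (cong (radius t) (Vec.lookup-map v tosses ω))))

        expected : ℕ → ℕ → Fin n → State
        expected t i v = mkState v (lookup ω v) t i (delays (r t) v) (labels r t v)
          (label t τ i v) (hi i v) (lo i v)
          where open Phase (adj G) (labels r t) (delays (r t))

        phase-begins : ∀ t v → begin-phase v (lookup ω v) t (k ∸ radius t (tosses (lookup ω v))) (labels r t v) ≡
          expected t 0 v
        phase-begins t v = cong (λ d → begin-phase v (lookup ω v) t d (labels r t v)) (delay≡ t v)

        inbox : ℕ → Fin n → Fin n → Maybe Message
        inbox T v u = if adj G v u then just (Protocol.send protocol (state ω T u) v) else nothing

        module _ (t i : ℕ) (ih : ∀ u → state ω (i + t * k) u ≡ expected t i u) (v : Fin n) where
          open Phase (adj G) (labels r t) (delays (r t))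
          open PhaseProperties G (labels r t) (delays (r t)) using (flood-≤)

          high-received : ∀ u → high-of (inbox (i + t * k) v u) ≡ (if adj G v u then hi i u else 0)
          high-received u with adj G v u
          ... | false = refl
          ... | true rewrite ih u = decode-high (lo i u) (flood-≤ (suc ∘ toℕ) Fin.toℕ<n i u)

          low-received : ∀ u → low-of (inbox (i + t * k) v u) ≡ (if adj G v u then lo i u else 0)
          low-received u with adj G v u
          ... | false = refl
          ... | true rewrite ih u = decode-low (hi i u) (flood-≤ (λ w → n ∸ toℕ w) (λ w → m∸n≤m n (toℕ w)) i u)

          received : state ω (suc i + t * k) v ≡ 
            (if suc i ≡ᵇ k
             then begin-phase v (lookup ω v) (suc t) (k ∸ radius (suc t) (tosses (lookup ω v))) (label t τ (suc i) v)
             else expected t (suc i) v)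
          received = trans
            (cong (λ s → Protocol.receive protocol s (inbox (i + t * k) v)) (ih v))
            (cong₂ (advance (expected t i v)) (maxF-cong high-received) (maxF-cong low-received))

        runs : ∀ t i → i < k → ∀ v → state ω (i + t * k) v ≡ expected t i v
        begins : ∀ t → 0 < k → ∀ v → state ω (t * k) v ≡ expected t 0 v

        runs t zero    0<k v = begins t 0<k v
        runs t (suc i) i<k v = trans (received t i (runs t i (<-trans (n<1+n i) i<k)) v)
          (cong (λ c → if c then begin-phase v (lookup ω v) (suc t)
                                        (k ∸ radius (suc t) (tosses (lookup ω v))) (label t τ (suc i) v)
                            else expected t (suc i) v) (≢⇒≡ᵇ-false (<⇒≢ i<k)))
          where
          open Phase (adj G) (labels r t) (delays (r t))
          ≢⇒≡ᵇ-false : ∀ {a b} → a ≢ b → (a ≡ᵇ b) ≡ false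
          ≢⇒≡ᵇ-false {a} {b} a≢b with a ≡ᵇ b in eq
          ... | true  = contradiction (≡ᵇ-true⁻¹ eq) a≢b
          ... | false = refl

        begins zero    0<k v = phase-begins 0 v
        begins (suc t) 0<k v = go k refl 0<k
          where
          go : ∀ k′ → k′ ≡ k → 0 < k′ → state ω (k + t * k) v ≡ expected (suc t) 0 v
          go (suc i) refl _ = trans (received t i (runs t i ≤-refl) v)
            (trans (cong (λ c → if c then begin-phase v (lookup ω v) (suc t)
                                        (k ∸ radius (suc t) (tosses (lookup ω v))) (labels r (suc t) v)
                                else expected t k v)
                         (≡ᵇ-true {k} refl))
                   (phase-begins (suc t) v))

      clustering≡labels : 0 < k → ∀ v → clustering ω v ≡ labels (radii (Vec.map tosses ω)) τ v
      clustering≡labels 0<k v = cong State.after (begins τ 0<k v)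

    module Decomposition (r : ℕ → Vec ℕ n) .{{_ : NonZero τ}} where

      private
        module P t = Phase (adj G) (labels r t) (delays (r t))
        module PP t = PhaseProperties G (labels r t) (delays (r t))

      codeOf : ℕ → Fin n → ℕ
      codeOf s c = s + suc (toℕ c) * τ

      codeOf≢0 : ∀ s c → codeOf s c ≢ 0
      codeOf≢0 s c eq = ≢-nonZero⁻¹ (suc (toℕ c) * τ) {{m*n≢0 (suc (toℕ c)) τ}} (m+n≡0⇒n≡0 s eq)

      labels-stable : ∀ t v → labels r t v ≢ 0 → labels r (suc t) v ≡ labels r t v
      labels-stable t v ≢0 with PP.label-cases t t τ k v
      ... | inj₁ (≡L , _) = ≡L
      ... | inj₂ (_ , _ , _ , J , _) = contradiction (≡ᵇ-true⁻¹ (PP.Join-active t J)) ≢0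

      labels-persist : ∀ {s t v} → s ≤ t → labels r s v ≢ 0 → labels r t v ≡ labels r s v
      labels-persist {s} {t} {v} s≤t ≢0 = go (≤⇒≤′ s≤t)
        where
        go : ∀ {t} → s ≤′ t → labels r t v ≡ labels r s v
        go ≤′-refl       = refl
        go (≤′-step {t} s≤t) = trans (labels-stable t v (subst (_≢ 0) (sym (go s≤t)) ≢0)) (go s≤t)

      Origin : ℕ → Fin n → Set
      Origin t v = ∃ λ s → ∃ λ c → ∃ λ i → s < t × i < k × PP.Join s v c i × labels r t v ≡ codeOf s c

      origin : ∀ t v → labels r t v ≢ 0 → Origin t v
      origin zero    v ≢0 = contradiction refl ≢0
      origin (suc t) v ≢0 with PP.label-cases t t τ k v
      ... | inj₁ (≡L , _) = let s , c , i , s<t , i<k , J , ≡c = origin t v (subst (_≢ 0) ≡L ≢0) in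
        s , c , i , m<n⇒m<1+n s<t , i<k , J , trans ≡L ≡c
      ... | inj₂ (c , i , i<k , J , ≡c) = t , c , i , ≤-refl , i<k , J , ≡c

      colour : ℕ → Fin τ
      colour C = C mod τ

      colour-codeOf : ∀ {s} c → s < τ → toℕ (colour (codeOf s c)) ≡ s
      colour-codeOf {s} c s<τ = trans (Fin.toℕ-fromℕ< _)
        (trans ([m+kn]%n≡m%n s (suc (toℕ c)) τ) (m<n⇒m%n≡m s<τ))

      codeOf-injective : ∀ {s s′ c c′} → s < τ → s′ < τ → codeOf s c ≡ codeOf s′ c′ → s ≡ s′ × c ≡ c′
      codeOf-injective {s} {s′} {c} {c′} s<τ s′<τ eq
        with trans (sym (colour-codeOf c s<τ)) (trans (cong (toℕ ∘ colour) eq) (colour-codeOf c′ s′<τ))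
      ... | refl = refl , Fin.toℕ-injective (suc-injective (*-cancelʳ-≡ _ _ τ (+-cancelˡ-≡ s _ _ eq)))

      module _ (all-labelled : ∀ v → labels r τ v ≢ 0) where

        -- The walk already carries a single label at the end of phase s, and nonzero labels
        -- persist.
        walk-to-centre : ∀ {s c i v} → s < τ → i < k → PP.Join s v c i →
          ∃ λ d → d < k × Walk G (Cluster G (labels r τ) (codeOf s c)) v c d
        walk-to-centre {s} {c} {i} s<τ i<k J@((d , p , le) , _) =
          d , ≤-<-trans (≤-trans (m≤n+m d _) le) i<k ,
          walk-map (λ {w} ≡c → trans (labels-persist s<τ (subst (_≢ 0) (sym ≡c) (codeOf≢0 s c))) ≡c)
                   (PP.Join-walk s s τ i<k p le J)

        strong-diameter : ∀ C → StrongDiameterAtMost G (2 * k ∸ 2) (Cluster G (labels r τ) C)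
        strong-diameter C u v uC vC
          with origin τ u (all-labelled u) | origin τ v (all-labelled v)
        ... | s , c , i , s<τ , i<k , J , ≡c | s′ , c′ , i′ , s′<τ , i′<k , J′ , ≡c′
          with trans (sym uC) ≡c | trans (sym vC) ≡c′
        ... | refl | C≡ with codeOf-injective {s} {s′} {c} {c′} s<τ s′<τ C≡
        ...   | refl , refl =
          let d  , d<k  , p  = walk-to-centre s<τ i<k J
              d′ , d′<k , p′ = walk-to-centre s<τ i′<k J′
              ℓ , dist , ℓ≤ = distance (λ w → labels r τ w ≟ codeOf s c) (walk-++ p (walk-reverse p′))
          in ℓ , dist , ≤-trans ℓ≤ (bound d<k d′<k)
          where
          bound : ∀ {d d′ k} → d < k → d′ < k → d + d′ ≤ 2 * k ∸ 2
          bound {d} {d′} {suc k} (s≤s d≤k) (s≤s d′≤k) rewrite +-identityʳ k | +-suc k k = +-mono-≤ d≤k d′≤k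

        colourable : SupergraphColorable G (labels r τ) τ
        colourable = colour , proper
          where
          proper : ∀ C C′ → SuperAdj G (labels r τ) C C′ → colour C ≢ colour C′
          proper C C′ (C≢C′ , u , v , uC , vC′ , a) same
            with origin τ u (all-labelled u) | origin τ v (all-labelled v)
          ... | s , c , i , s<τ , i<k , J , ≡c | s′ , c′ , i′ , s′<τ , i′<k , J′ , ≡c′
            with trans (sym uC) ≡c | trans (sym vC′) ≡c′
          ... | refl | refl with trans (sym (colour-codeOf c s<τ)) (trans (cong toℕ same) (colour-codeOf c′ s′<τ))
          ...   | refl = C≢C′ (cong (codeOf s) (PP.Join-adj s a J J′))

-- Survival probabilities

nth-updateAt-same : ∀ {A : Set} {n} d (xs : Vec A n) (i : Fin n) {f} →
  nth d (toℕ i) (updateAt xs i f) ≡ f (nth d (toℕ i) xs)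
nth-updateAt-same d (x ∷ xs) zero    = refl
nth-updateAt-same d (x ∷ xs) (suc i) = nth-updateAt-same d xs i

nth-updateAt-before : ∀ {A : Set} {n} d (xs : Vec A n) (i : Fin n) {f s} → s < toℕ i →
  nth d s (updateAt xs i f) ≡ nth d s xs
nth-updateAt-before d (x ∷ xs) (suc i) {s = zero}  _         = refl
nth-updateAt-before d (x ∷ xs) (suc i) {s = suc s} (s≤s s<i) = nth-updateAt-before d xs i s<i

does-true : ∀ {P : Set} (P? : Dec P) → does P? ≡ true → P
does-true (yes p) _ = p

does-false : ∀ {P : Set} (P? : Dec P) → does P? ≡ false → ¬ P
does-false (no ¬p) _ = ¬p

module Probability (n k τ b : ℕ) (θ : ℕ → ℕ) (G : Graph n) (θ≤ : ∀ t → θ t ≤ 2 ^ b) where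
  open Parameters n k τ b θ
  open Run G

  Block* : List Block
  Block* = blocks b (suc k)

  Ω* : List (Vec (Vec Block τ) n)
  Ω* = allVecs (allVecs Block* τ) n

  redraw : Fin n → Fin τ → Vec (Vec Block τ) n → Block → Vec (Vec Block τ) n
  redraw v t ω x = updateAt ω v (λ Z → updateAt Z t (const x))

  redraw-resamples : ∀ v t → Resamples (redraw v t) Ω* Block*
  redraw-resamples v t = updateAt-resamples {T = λ Z x → updateAt Z t (const x)} {allVecs Block* τ} {Block*} v
    (updateAt-resamples {T = λ _ x → x} {Block*} {Block*} t (const-resamples Block*))

  radii-before : ∀ v t ω x {s} → s < toℕ t → radii (redraw v t ω x) s ≡ radii ω s
  radii-before v t ω x {s} s<t = trans
    (Vec.map-updateAt {h = λ r → r} ω v (cong (geo (θ s)) (nth-updateAt-before noBlock (lookup ω v) t s<t)))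
    (Vec.updateAt-id v (radii ω s))

  radii-same : ∀ v t ω x → lookup (radii (redraw v t ω x) (toℕ t)) v ≡ geo (θ (toℕ t)) x
  radii-same v t ω x = trans (Vec.lookup-map v (radius (toℕ t)) (redraw v t ω x))
    (trans (cong (radius (toℕ t)) (Vec.lookup∘updateAt v ω))
           (cong (geo (θ (toℕ t))) (nth-updateAt-same noBlock (lookup ω v) t)))

  radii-other : ∀ v t ω x {u s} → u ≢ v → lookup (radii (redraw v t ω x) s) u ≡ lookup (radii ω s) u
  radii-other v t ω x {u} {s} u≢v = trans (Vec.lookup-map u (radius s) (redraw v t ω x))
    (trans (cong (radius s) (Vec.lookup∘updateAt′ u v u≢v ω)) (sym (Vec.lookup-map u (radius s) ω)))

  -- Causality: a block of phase t can be redrawn without touching the state in which that phase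
  -- starts.
  labels-cong : ∀ t {r r′} → (∀ {s} → s < t → r s ≡ r′ s) → labels r t ≡ labels r′ t
  labels-cong zero    eq = refl
  labels-cong (suc t) eq = cong₂ (λ L d v → Phase.label (adj G) L (delays d) t τ k v)
    (labels-cong t (λ s<t → eq (m<n⇒m<1+n s<t))) (eq ≤-refl)

  abstract
    overflow? : (L : Fin n → ℕ) (d : Vec ℕ n) → Dec (∃ λ v → (L v ≡ᵇ 0) ≡ true × (lookup d v ≡ᵇ suc k) ≡ true)
    overflow? L d = Fin.any? (λ v → ((L v ≡ᵇ 0) Bool.≟ true) ×-dec ((lookup d v ≡ᵇ suc k) Bool.≟ true))

  -- The radius k + 1 is where truncation breaks memorylessness; runs in which an
  -- active vertex draws it are counted as failures.
  good : (ℕ → Vec ℕ n) → ℕ → Bool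
  good r zero    = true
  good r (suc t) = good r t ∧ not (does (overflow? (labels r t) (r t)))

  good-cong : ∀ t {r r′} → (∀ {s} → s < t → r s ≡ r′ s) → good r t ≡ good r′ t
  good-cong zero    eq = refl
  good-cong (suc t) eq = cong₂ _∧_ (good-cong t (eq ∘ m<n⇒m<1+n))
    (cong₂ (λ L d → not (does (overflow? L d))) (labels-cong t (eq ∘ m<n⇒m<1+n)) (eq ≤-refl))

  -- With `good` included, a run drops out as soon as an active radius is truncated. This keeps
  -- `decay` free of error terms; truncations are charged separately in `overflows`.
  survives : (ℕ → Vec ℕ n) → ℕ → Fin n → Bool
  survives r t y = good r t ∧ (labels r t y ≡ᵇ 0)

  survives-cong : ∀ t y {r r′} → (∀ {s} → s < t → r s ≡ r′ s) → survives r t y ≡ survives r′ t y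
  survives-cong t y eq = cong₂ (λ g L → g ∧ (L y ≡ᵇ 0)) (good-cong t eq) (labels-cong t eq)

  survivors : ℕ → Fin n → ℕ
  survivors t y = ∑ Ω* (λ ω → 𝟙 (survives (radii ω) t y))

  -- The radius ρ of v is a separate argument, so that for fixed other radii winning becomes a
  -- monotone event of ρ alone.
  winsWith : (Fin n → ℕ) → Vec ℕ n → Fin n → Fin n → ℕ → Bool
  winsWith L d v y ρ = does (PhaseProperties.wins? G L (delays d) k v (k ∸ ρ) y)

  winsWith-local : ∀ L {d d′} v y ρ → (∀ {u} → u ≢ v → lookup d u ≡ lookup d′ u) →
    winsWith L d v y ρ ≡ winsWith L d′ v y ρ
  winsWith-local L {d} {d′} v y ρ eq = does-⇔ (mk⇔ (transport {d} {d′} eq) (transport {d′} {d} (sym ∘ eq)))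
    (PhaseProperties.wins? G L (delays d) k v (k ∸ ρ) y) (PhaseProperties.wins? G L (delays d′) k v (k ∸ ρ) y)
    where
    open module P d = PhaseProperties G L (delays d) using (Wins)
    transport : ∀ {d d′ : Vec ℕ n} → (∀ {u} → u ≢ v → lookup d u ≡ lookup d′ u) →
      Wins d k v (k ∸ ρ) y → Wins d′ k v (k ∸ ρ) y
    transport eq (i , i≤k , near , others) = i , i≤k , near , λ u u≢v →
      subst (λ e → ¬ Near (suc (k ∸ e)) i y u × (Near (k ∸ e) i y u → toℕ u < toℕ v)) (eq u≢v) (others u u≢v)
      where open PhaseProperties G L (λ _ → 0) using (Near)

  module _ (t : Fin τ) where
    private
      t′ = toℕ t
      D = 2 ^ b

    open Geometric b (θ t′) (θ≤ t′)

    radii-≤ : ∀ ω v → lookup (radii ω t′) v ≤ suc k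
    radii-≤ ω v = subst (_≤ suc k) (sym (Vec.lookup-map v (radius t′) ω)) (geo-≤ (θ t′) (nth noBlock t′ (lookup ω v)))

    -- Conditioning on everything but one radius, in terms of counts: `F ω` ignores the redrawn
    -- block, so the radius in its second argument can be replaced by an independent one.
    redraw-radius : ∀ v (F : Vec (Vec Block τ) n → ℕ → ℕ) → (∀ ω x j → F (redraw v t ω x) j ≡ F ω j) →
      length Block* * ∑ Ω* (λ ω → F ω (lookup (radii ω t′) v)) ≡
      ∑ Ω* (λ ω → ∑ Block* (λ x → F ω (geo (θ t′) x)))
    redraw-radius v F inv = trans (sym (redraw-resamples v t (λ ω → F ω (lookup (radii ω t′) v))))
      (∑-cong Ω* λ ω → ∑-cong Block* λ x → trans (inv ω x _) (cong (F ω) (radii-same v t ω x)))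

    overflows : Fin n → ℕ
    overflows v = ∑ Ω* (λ ω → 𝟙 (survives (radii ω) t′ v ∧ (lookup (radii ω t′) v ≡ᵇ suc k)))

    -- Survival up to phase t was settled by earlier blocks and is therefore independent of the
    -- radius drawn now.
    ∑-overflows : ∀ v → length Block* * overflows v ≡ θ t′ ^ suc k * survivors t′ v
    ∑-overflows v = begin
      length Block* * overflows v
        ≡⟨ redraw-radius v (λ ω j → 𝟙 (survives (radii ω) t′ v ∧ (j ≡ᵇ suc k)))
             (λ ω x j → cong (λ s → 𝟙 (s ∧ (j ≡ᵇ suc k))) (survives-cong t′ v (radii-before v t ω x))) ⟩
      ∑ Ω* (λ ω → ∑ Block* (λ x → 𝟙 (survives (radii ω) t′ v ∧ (geo (θ t′) x ≡ᵇ suc k))))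
        ≡⟨ ∑-cong Ω* (λ ω → count (survives (radii ω) t′ v)) ⟩
      ∑ Ω* (λ ω → θ t′ ^ suc k * 𝟙 (survives (radii ω) t′ v))
        ≡⟨ ∑-* (θ t′ ^ suc k) Ω* _ ⟨
      θ t′ ^ suc k * survivors t′ v ∎
      where
      open ≡-Reasoning
      count : ∀ s → ∑ Block* (λ x → 𝟙 (s ∧ (geo (θ t′) x ≡ᵇ suc k))) ≡ θ t′ ^ suc k * 𝟙 s
      count true  = trans (∑-geo-max (suc k)) (sym (*-identityʳ _))
      count false = trans (∑≡0 Block* (λ _ → refl)) (sym (*-zeroʳ (θ t′ ^ suc k)))

    module _ (y : Fin n) where

      winning shifted : Fin n → Vec (Vec Block τ) n → ℕ → Bool
      winning v ω ρ = survives (radii ω) t′ y ∧ winsWith (labels (radii ω) t′) (radii ω t′) v y ρ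
      shifted v ω ρ = survives (radii ω) t′ y ∧ shift (winsWith (labels (radii ω) t′) (radii ω t′) v y) ρ

      winsWith-redraw : ∀ v ω x ρ → winsWith (labels (radii (redraw v t ω x)) t′) (radii (redraw v t ω x) t′) v y ρ ≡
        winsWith (labels (radii ω) t′) (radii ω t′) v y ρ
      winsWith-redraw v ω x ρ = trans
        (cong (λ L → winsWith L (radii (redraw v t ω x) t′) v y ρ)
          (labels-cong t′ {radii (redraw v t ω x)} {radii ω} (radii-before v t ω x)))
        (winsWith-local (labels (radii ω) t′) {radii (redraw v t ω x) t′} {radii ω t′} v y ρ (radii-other v t ω x))

      memoryless-winning : ∀ v →
        θ t′ * ∑ Ω* (λ ω → 𝟙 (winning v ω (lookup (radii ω t′) v))) ≤
        D * ∑ Ω* (λ ω → 𝟙 (shifted v ω (lookup (radii ω t′) v)))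
      memoryless-winning v = *-cancelˡ-≤ (length Block*) {{blocks≢0}} (begin
        length Block* * (θ t′ * ∑ Ω* (λ ω → 𝟙 (winning v ω (lookup (radii ω t′) v))))
          ≡⟨ swap (length Block*) (θ t′) _ ⟩
        θ t′ * (length Block* * ∑ Ω* (λ ω → 𝟙 (winning v ω (lookup (radii ω t′) v))))
          ≡⟨ cong (θ t′ *_) (redraw-radius v (λ ω ρ → 𝟙 (winning v ω ρ)) (λ ω x ρ → cong 𝟙
               (cong₂ _∧_ (survives-cong t′ y (radii-before v t ω x)) (winsWith-redraw v ω x ρ)))) ⟩
        θ t′ * ∑ Ω* (λ ω → ∑ Block* (λ x → 𝟙 (winning v ω (geo (θ t′) x))))
          ≡⟨ ∑-* (θ t′) Ω* _ ⟩
        ∑ Ω* (λ ω → θ t′ * ∑ Block* (λ x → 𝟙 (winning v ω (geo (θ t′) x))))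
          ≤⟨ ∑-mono Ω* (λ ω → pointwise (survives (radii ω) t′ y) (labels (radii ω) t′) (radii ω t′)) ⟩
        ∑ Ω* (λ ω → D * ∑ Block* (λ x → 𝟙 (shifted v ω (geo (θ t′) x))))
          ≡⟨ ∑-* D Ω* _ ⟨
        D * ∑ Ω* (λ ω → ∑ Block* (λ x → 𝟙 (shifted v ω (geo (θ t′) x))))
          ≡⟨ cong (D *_) (redraw-radius v (λ ω ρ → 𝟙 (shifted v ω ρ)) (λ ω x ρ → cong 𝟙
               (cong₂ _∧_ (survives-cong t′ y (radii-before v t ω x)) (shift-cong (winsWith-redraw v ω x) ρ)))) ⟨
        D * (length Block* * ∑ Ω* (λ ω → 𝟙 (shifted v ω (lookup (radii ω t′) v))))
          ≡⟨ swap (length Block*) D _ ⟨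
        length Block* * (D * ∑ Ω* (λ ω → 𝟙 (shifted v ω (lookup (radii ω t′) v)))) ∎)
        where
        open ≤-Reasoning
        swap : ∀ x y z → x * (y * z) ≡ y * (x * z)
        swap = solve-∀
        blocks≢0 : NonZero (length Block*)
        blocks≢0 = subst NonZero (sym (length-blocks b (suc k))) (m^n≢0 D (suc k) {{m^n≢0 2 b}})
        shift-cong : ∀ {f g} → (∀ ρ → f ρ ≡ g ρ) → ∀ ρ → shift f ρ ≡ shift g ρ
        shift-cong eq zero    = refl
        shift-cong eq (suc ρ) = eq ρ
        pointwise : ∀ s L d →
          θ t′ * ∑ Block* (λ x → 𝟙 (s ∧ winsWith L d v y (geo (θ t′) x))) ≤
          D * ∑ Block* (λ x → 𝟙 (s ∧ shift (winsWith L d v y) (geo (θ t′) x)))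
        pointwise true L d = memoryless k (winsWith L d v y)
          (λ ρ w → dec-true (wins? k v (k ∸ suc ρ) y)
            (wins-anti (∸-monoʳ-≤ k (n≤1+n ρ)) (does-true (wins? k v (k ∸ ρ) y) w)))
          -- Radii k and k + 1 both mean emission at time 0, as the truncation in `memoryless`
          -- demands.
          (cong (λ s → does (wins? k v s y)) (trans (m≤n⇒m∸n≡0 (n≤1+n k)) (sym (n∸n≡0 k))))
          where open PhaseProperties G L (delays d)
        pointwise false L d = subst (_≤ D * ∑ Block* (λ _ → 0))
          (sym (trans (cong (θ t′ *_) (∑≡0 Block* (λ _ → refl))) (*-zeroʳ (θ t′)))) z≤n

      some-winner : ∀ ω → 𝟙 (survives (radii ω) t′ y) ≤ ∑ (allFin n) (λ v → 𝟙 (winning v ω (lookup (radii ω t′) v)))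
      some-winner ω with survives (radii ω) t′ y in surv
      ... | false = z≤n
      ... | true =
        let v , w = wins-exists (proj₂ (∧-true {good (radii ω) t′} surv)) (m∸n≤m k (lookup (radii ω t′) y)) in
        ≤-trans (≤-reflexive (sym (cong 𝟙 (dec-true (wins? k v (delays (radii ω t′) v) y) w))))
          (∑-∈ (λ v → 𝟙 (winsWith (labels (radii ω) t′) (radii ω t′) v y (lookup (radii ω t′) v))) (∈-allFin v))
        where open PhaseProperties G (labels (radii ω) t′) (delays (radii ω t′))

      -- Whoever wins with one unit less also wins with the actual radius, so at most one v counts.
      -- Then y joins v, unless the radius of v is k + 1; in that case the run ceases to be `good`.
      winner-leaves : ∀ ω → 𝟙 (survives (radii ω) (suc t′) y) +
        ∑ (allFin n) (λ v → 𝟙 (shifted v ω (lookup (radii ω t′) v))) ≤ 𝟙 (survives (radii ω) t′ y)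
      winner-leaves ω = begin
        𝟙 (survives r (suc t′) y) + ∑ (allFin n) S
          ≤⟨ go (survives r t′ y) (survives r (suc t′) y) refl refl ⟩
        𝟙 (survives r t′ y) ∎
        where
        open ≤-Reasoning
        r = radii ω
        open PhaseProperties G (labels r t′) (delays (r t′))
        open Phase (adj G) (labels r t′) (delays (r t′)) using (label)
        S : Fin n → ℕ
        S v = 𝟙 (shifted v ω (lookup (r t′) v))

        stays : survives r (suc t′) y ≡ true → survives r t′ y ≡ true
        stays eq with ∧-true {good r (suc t′)} eq
        ... | g , l with ∧-true {good r t′} g
        ...   | g′ , _ with label-cases t′ τ k y
        ...     | inj₁ (≡L , _) rewrite g′ = trans (cong (_≡ᵇ 0) (sym ≡L)) l
        ...     | inj₂ (_ , _ , _ , J , _) rewrite g′ = Join-active J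

        shifted-cases : ∀ v → S v ≢ 0 →
          ∃ λ ρ → lookup (r t′) v ≡ suc ρ × Wins k v (k ∸ ρ) y × survives r t′ y ≡ true
        shifted-cases v S≢0 with survives r t′ y | lookup (r t′) v
        ... | false | _     = contradiction refl S≢0
        ... | true  | zero  = contradiction refl S≢0
        ... | true  | suc ρ with winsWith (labels r t′) (r t′) v y ρ in w
        ...   | false = contradiction refl S≢0
        ...   | true  = ρ , refl , does-true (wins? k v (k ∸ ρ) y) w , refl

        unique : ∀ v v′ → S v ≢ 0 → S v′ ≢ 0 → v ≡ v′
        unique v v′ S≢0 S′≢0 with shifted-cases v S≢0 | shifted-cases v′ S′≢0
        ... | ρ , eq , w , _ | ρ′ , eq′ , w′ , _ = wins-unique (weaken eq w) (weaken eq′ w′)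
          where
          weaken : ∀ {v ρ} → lookup (r t′) v ≡ suc ρ → Wins k v (k ∸ ρ) y → Wins k v (delays (r t′) v) y
          weaken {ρ = ρ} eq = wins-anti (subst (λ e → k ∸ e ≤ k ∸ ρ) (sym eq) (∸-monoʳ-≤ k (n≤1+n ρ)))

        leaves : ∀ v → S v ≢ 0 → survives r (suc t′) y ≢ true
        leaves v S≢0 eq with shifted-cases v S≢0 | ∧-true {good r (suc t′)} eq
        ... | ρ , ≡ρ , w , _ | g , l with ρ <? k
        ...   | yes ρ<k =
          let i , i<k , join = wins⇒Join (subst (λ s → Wins k v s y)
                (trans (+-∸-assoc 1 ρ<k) (cong (λ e → suc (k ∸ e)) (sym ≡ρ))) w) in
          contradiction (trans (sym (Join⇒label t′ τ i<k join)) (≡ᵇ-true⁻¹ l))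
            (Decomposition.codeOf≢0 r {{Fin.nonZeroIndex t}} t′ v)
        ...   | no ρ≮k = contradiction
            (v , wins⇒active w , ≡ᵇ-true (≤-antisym (radii-≤ ω v) (subst (suc k ≤_) (sym ≡ρ) (s≤s (≮⇒≥ ρ≮k)))))
            (does-false (overflow? (labels r t′) (r t′)) (Bool.not-injective (proj₂ (∧-true {good r t′} g))))

        go : ∀ s s′ → survives r t′ y ≡ s → survives r (suc t′) y ≡ s′ → 𝟙 s′ + ∑ (allFin n) S ≤ 𝟙 s
        go false true  eq eq′ with () ← trans (sym eq) (stays eq′)
        go true  true  eq eq′ = s≤s (≤-reflexive (∑≡0 (allFin n) (λ v →
          decidable-stable (S v ≟ 0) (λ S≢0 → leaves v S≢0 eq′))))
        go true  false eq eq′ = ∑-tabulate≤1 (λ v → v) S (λ v → 𝟙≤1 (shifted v ω (lookup (r t′) v))) unique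
        go false false eq eq′ = ≤-reflexive (∑≡0 (allFin n) (λ v → decidable-stable (S v ≟ 0)
          (λ S≢0 → contradiction (trans (sym eq) (proj₂ (proj₂ (proj₂ (shifted-cases v S≢0))))) λ ())))

      -- Every survivor has a winner, and each v keeps a spare unit with conditional probability at
      -- least θ/D. The sum over v loses nothing because the events with a spare unit are disjoint,
      -- and each of them removes y from the survivors.
      decay : D * survivors (suc t′) y + θ t′ * survivors t′ y ≤ D * survivors t′ y
      decay = begin
        D * survivors (suc t′) y + θ t′ * survivors t′ y
          ≤⟨ +-monoʳ-≤ (D * survivors (suc t′) y) (*-monoʳ-≤ (θ t′) (≤-trans (∑-mono Ω* some-winner)
               (≤-reflexive (∑-swap Ω* (allFin n) _)))) ⟩
        D * survivors (suc t′) y + θ t′ * ∑ (allFin n) (λ v → ∑ Ω* (λ ω → 𝟙 (winning v ω (lookup (radii ω t′) v))))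
          ≡⟨ cong (D * survivors (suc t′) y +_) (∑-* (θ t′) (allFin n) _) ⟩
        D * survivors (suc t′) y + ∑ (allFin n) (λ v → θ t′ * ∑ Ω* (λ ω → 𝟙 (winning v ω (lookup (radii ω t′) v))))
          ≤⟨ +-monoʳ-≤ (D * survivors (suc t′) y) (∑-mono (allFin n) memoryless-winning) ⟩
        D * survivors (suc t′) y + ∑ (allFin n) (λ v → D * ∑ Ω* (λ ω → 𝟙 (shifted v ω (lookup (radii ω t′) v))))
          ≡⟨ cong (D * survivors (suc t′) y +_) (∑-* D (allFin n) _) ⟨
        D * survivors (suc t′) y + D * ∑ (allFin n) (λ v → ∑ Ω* (λ ω → 𝟙 (shifted v ω (lookup (radii ω t′) v))))
          ≡⟨ *-distribˡ-+ D (survivors (suc t′) y) _ ⟨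
        D * (survivors (suc t′) y + ∑ (allFin n) (λ v → ∑ Ω* (λ ω → 𝟙 (shifted v ω (lookup (radii ω t′) v)))))
          ≡⟨ cong (λ s → D * (survivors (suc t′) y + s)) (∑-swap Ω* (allFin n) _) ⟨
        D * (survivors (suc t′) y + ∑ Ω* (λ ω → ∑ (allFin n) (λ v → 𝟙 (shifted v ω (lookup (radii ω t′) v)))))
          ≡⟨ cong (D *_) (∑-+ Ω* _ _) ⟨
        D * ∑ Ω* (λ ω → 𝟙 (survives (radii ω) (suc t′) y) + ∑ (allFin n) (λ v → 𝟙 (shifted v ω (lookup (radii ω t′) v))))
          ≤⟨ *-monoʳ-≤ D (∑-mono Ω* winner-leaves) ⟩
        D * survivors t′ y ∎
        where open ≤-Reasoning

  abstract
    labelled? : (r : ℕ → Vec ℕ n) → Dec (∀ v → labels r τ v ≢ 0)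
    labelled? r = Fin.all? (λ v → ¬? (labels r τ v ≟ 0))

  failures : ℕ
  failures = ∑ Ω* (λ ω → 𝟙 (not (does (labelled? (radii ω)))))

  -- Choosing the first overflow ensures that the run is still `good` before it, as `overflows`
  -- requires.
  first-overflow : ∀ (r : ℕ → Vec ℕ n) t → good r t ≡ false → ∃ λ s → ∃ λ v → s < t ×
    survives r s v ∧ (lookup (r s) v ≡ᵇ suc k) ≡ true
  first-overflow r (suc t) eq with good r t in g
  ... | false = let s , v , s<t , e = first-overflow r t g in s , v , m<n⇒m<1+n s<t , e
  ... | true  = let v , a , o = does-true (overflow? (labels r t) (r t)) (Bool.not-injective eq) in
    t , v , ≤-refl , cong₂ _∧_ (cong₂ _∧_ g a) o

  failures-≤ : failures ≤
    ∑ (allFin τ) (λ t → ∑ (allFin n) (overflows t)) + ∑ (allFin n) (survivors τ)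
  failures-≤ = begin
    failures
      ≤⟨ ∑-mono Ω* pointwise ⟩
    ∑ Ω* (λ ω → ∑ (allFin τ) (λ t → ∑ (allFin n) (O ω t)) + ∑ (allFin n) (S ω))
      ≡⟨ ∑-+ Ω* _ _ ⟩
    ∑ Ω* (λ ω → ∑ (allFin τ) (λ t → ∑ (allFin n) (O ω t))) + ∑ Ω* (λ ω → ∑ (allFin n) (S ω))
      ≡⟨ cong₂ _+_ (trans (∑-swap Ω* (allFin τ) _) (∑-cong (allFin τ) (λ t → ∑-swap Ω* (allFin n) _)))
                   (∑-swap Ω* (allFin n) _) ⟩
    ∑ (allFin τ) (λ t → ∑ (allFin n) (overflows t)) + ∑ (allFin n) (survivors τ) ∎
    where
    open ≤-Reasoning
    O : Vec (Vec Block τ) n → Fin τ → Fin n → ℕ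
    O ω t v = 𝟙 (survives (radii ω) (toℕ t) v ∧ (lookup (radii ω (toℕ t)) v ≡ᵇ suc k))
    S : Vec (Vec Block τ) n → Fin n → ℕ
    S ω v = 𝟙 (survives (radii ω) τ v)
    pointwise : ∀ ω → 𝟙 (not (does (labelled? (radii ω)))) ≤
      ∑ (allFin τ) (λ t → ∑ (allFin n) (O ω t)) + ∑ (allFin n) (S ω)
    pointwise ω = cases (labelled? r) (good r τ) refl
      where
      r = radii ω
      cases : (l : Dec (∀ v → labels r τ v ≢ 0)) → ∀ g → good r τ ≡ g →
        𝟙 (not (does l)) ≤ ∑ (allFin τ) (λ t → ∑ (allFin n) (O ω t)) + ∑ (allFin n) (S ω)
      cases (yes _) _ _ = z≤n
      cases (no ¬all) true g =
        let v , ¬≢0 = Fin.¬∀⟶∃¬ n _ (λ v → ¬? (labels r τ v ≟ 0)) ¬all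
            ≡0 = decidable-stable (labels r τ v ≟ 0) ¬≢0 in
        ≤-trans (≤-trans (≤-reflexive (sym (cong 𝟙 (cong₂ _∧_ g (≡ᵇ-true ≡0))))) (∑-∈ (S ω) (∈-allFin v)))
                (m≤n+m _ (∑ (allFin τ) (λ t → ∑ (allFin n) (O ω t))))
      cases (no _) false g =
        let s , v , s<τ , e = first-overflow r τ g
            t = Fin.fromℕ< s<τ in
        ≤-trans (≤-reflexive (sym (trans
                  (cong (λ s → 𝟙 (survives r s v ∧ (lookup (r s) v ≡ᵇ suc k))) (Fin.toℕ-fromℕ< s<τ))
                  (cong 𝟙 e))))
          (≤-trans (∑-∈ (O ω t) (∈-allFin v))
          (≤-trans (∑-∈ (λ t → ∑ (allFin n) (O ω t)) (∈-allFin t)) (m≤m+n _ _)))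

-- Rising products, the schedule of success probabilities, and the failure count

-- (j + 1) (j + 2) ⋯ (j + K)
rising : ℕ → ℕ → ℕ
rising zero    j = 1
rising (suc K) j = suc j * rising K (suc j)

-- Both sides are (j + 1) ⋯ (j + K + 1). The ratio (j + 1)/(j + 1 + K) of consecutive products is
-- the survival factor of a phase for K = k + 1, which makes the factors telescope.
rising-shift : ∀ K j → rising K (suc j) * suc j ≡ rising K j * (suc j + K)
rising-shift zero    j = cong (1 *_) (sym (+-identityʳ (suc j)))
rising-shift (suc K) j = begin
  suc (suc j) * rising K (suc (suc j)) * suc j
    ≡⟨ lemma₁ (suc (suc j)) (rising K (suc (suc j))) (suc j) ⟩
  suc j * (rising K (suc (suc j)) * suc (suc j))
    ≡⟨ cong (suc j *_) (rising-shift K (suc j)) ⟩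
  suc j * (rising K (suc j) * (suc (suc j) + K))
    ≡⟨ lemma₂ j (rising K (suc j)) K ⟩
  suc j * rising K (suc j) * (suc j + suc K) ∎
  where
  open ≡-Reasoning
  lemma₁ : ∀ a r c → a * r * c ≡ c * (r * a)
  lemma₁ = solve-∀
  lemma₂ : ∀ j r K → suc j * (r * (suc (suc j) + K)) ≡ suc j * r * (suc j + suc K)
  lemma₂ = solve-∀

rising-≤ : ∀ K j → rising K j ≤ (K + j) ^ K
rising-≤ zero    j = ≤-refl
rising-≤ (suc K) j = *-mono-≤ (s≤s (m≤n+m j K))
  (subst (λ m → rising K (suc j) ≤ m ^ K) (+-suc K j) (rising-≤ K (suc j)))

^≤rising : ∀ K j → suc j ^ K ≤ rising K j
^≤rising zero    j = ≤-refl
^≤rising (suc K) j = *-monoʳ-≤ (suc j) (≤-trans (^-monoˡ-≤ K (n≤1+n (suc j))) (^≤rising K (suc j)))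

-- After multiplication by e^k the left side is A² (Ae)^k, at most (Ea)^(k + 1), and the hypothesis
-- on a^(k + 1) applies.
^-step : ∀ k {a e A E c} .{{_ : NonZero e}} → A * A ≤ E * a → A * e ≤ E * a →
  a ^ suc k ≤ c * e ^ k → A ^ suc (suc k) ≤ c * E ^ suc k
^-step k {a} {e} {A} {E} {c} AA≤ Ae≤ ih = *-cancelʳ-≤ _ _ (e ^ k) {{m^n≢0 e k}} (begin
  A ^ suc (suc k) * e ^ k        ≡⟨ regroup A (A ^ k) (e ^ k) ⟩
  A * A * (A ^ k * e ^ k)        ≡⟨ cong (A * A *_) (^-*-distrib A e k) ⟨
  A * A * (A * e) ^ k            ≤⟨ *-mono-≤ AA≤ (^-monoˡ-≤ k Ae≤) ⟩
  (E * a) ^ suc k                ≡⟨ ^-*-distrib E a (suc k) ⟩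
  E ^ suc k * a ^ suc k          ≤⟨ *-monoʳ-≤ (E ^ suc k) ih ⟩
  E ^ suc k * (c * e ^ k)        ≡⟨ assoc (E ^ suc k) c (e ^ k) ⟩
  c * E ^ suc k * e ^ k          ∎)
  where
  open ≤-Reasoning
  regroup : ∀ x y z → x * (x * y) * z ≡ x * x * (y * z)
  regroup = solve-∀
  assoc : ∀ x y z → x * (y * z) ≡ y * x * z
  assoc = solve-∀

-- For k = 1 this reads 9 ≤ 10, so no smaller integer than 5 would do. The induction step requires
-- (k + 3)² ≤ 2 (k + 1)(k + 2), which first holds at k = 3; hence three base cases.
factor-bound : ∀ k .{{_ : NonZero k}} → (k + 2) ^ suc k ≤ 5 * (2 * k) ^ k
factor-bound 1 = toWitness {a? = 3 ^ 2 ≤? 5 * 2 ^ 1} _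
factor-bound 2 = toWitness {a? = 4 ^ 3 ≤? 5 * 4 ^ 2} _
factor-bound 3 = toWitness {a? = 5 ^ 4 ≤? 5 * 6 ^ 3} _
factor-bound (suc k@(suc (suc (suc j)))) = ^-step k {k + 2} {2 * k} {suc k + 2} {2 * suc k} {5}
  (m+n≤o⇒m≤o _ (≤-reflexive (sym (square j))))
  (m+n≤o⇒m≤o _ (≤-reflexive (sym (product k))))
  (factor-bound k)
  where
  square : ∀ j → 2 * (4 + j) * (3 + j + 2) ≡ (4 + j + 2) * (4 + j + 2) + (4 + 6 * j + j * j)
  square = solve-∀
  product : ∀ k → 2 * suc k * (k + 2) ≡ (suc k + 2) * (2 * k) + 4
  product = solve-∀

∑-≤-const : ∀ {A : Set} (xs : List A) {f c} → (∀ x → f x ≤ c) → ∑ xs f ≤ length xs * c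
∑-≤-const xs {f} {c} f≤c = ≤-trans (∑-mono xs f≤c) (≤-reflexive (∑-const xs c))

-- θ t / D is (k + 1) / (τ + k − t) rounded up, which is 1 in the last phase.
module Schedule (k τ D : ℕ) where

  remaining : ℕ → ℕ
  remaining t = suc k + (τ ∸ suc t)

  θ : ℕ → ℕ
  θ t = suc (suc k * D / remaining t) ⊓ D

  θ≤D : ∀ t → θ t ≤ D
  θ≤D t = m⊓n≤n _ D

  θ-lower : ∀ t → suc k * D ≤ θ t * remaining t
  θ-lower t with ⊓-sel (suc (suc k * D / remaining t)) D
  ... | inj₁ eq rewrite eq = begin
    suc k * D                                            ≡⟨ m≡m%n+[m/n]*n (suc k * D) m ⟩
    suc k * D % m + suc k * D / m * m                    ≤⟨ +-monoˡ-≤ _ (<⇒≤ (m%n<n (suc k * D) m)) ⟩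
    m + suc k * D / m * m                                ∎
    where
    open ≤-Reasoning
    m = remaining t
  ... | inj₂ eq rewrite eq = ≤-trans (≤-reflexive (*-comm (suc k) D)) (*-monoʳ-≤ D (m≤m+n (suc k) _))

  remaining≤D : ∀ {t} → τ + k ≤ D → t < τ → remaining t ≤ D
  remaining≤D {t} τ+k≤D t<τ = ≤-trans (≤-trans (≤-reflexive (sym (+-suc k _)))
    (≤-trans (+-monoʳ-≤ k (≤-trans (s≤s (∸-monoʳ-≤ τ (s≤s (z≤n {t})))) (≤-reflexive (m+[n∸m]≡n {1} (≤-trans (s≤s z≤n) t<τ)))))
             (≤-reflexive (+-comm k τ)))) τ+k≤D

  -- Rounding up adds at most one `remaining t`, itself at most D; this turns k + 1 into k + 2.
  θ-upper : ∀ {t} → τ + k ≤ D → t < τ → θ t * remaining t ≤ (k + 2) * D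
  θ-upper {t} τ+k≤D t<τ = begin
    θ t * m                        ≤⟨ *-monoˡ-≤ m (m⊓n≤m _ D) ⟩
    m + suc k * D / m * m          ≤⟨ +-mono-≤ (remaining≤D {t} τ+k≤D t<τ) (m/n*n≤m (suc k * D) m) ⟩
    D + suc k * D                  ≡⟨ lemma k D ⟩
    (k + 2) * D                    ∎
    where
    open ≤-Reasoning
    m = remaining t
    lemma : ∀ k D → D + suc k * D ≡ (k + 2) * D
    lemma = solve-∀

module FailureBound (n k τ b : ℕ) .{{_ : NonZero τ}} (τ+k≤D : τ + k ≤ 2 ^ b) (G : Graph n) where

  D : ℕ
  D = 2 ^ b

  open Schedule k τ D
  open Probability n k τ b θ G θ≤D public

  private
    Total R : ℕ
    Total = length Ω*
    R = rising (suc k) (τ ∸ 1)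

    instance
      D≢0 : NonZero D
      D≢0 = m^n≢0 2 b

  -- The factor is 1 - (k + 1)/`remaining t`, whose numerator is what `remaining t` has beyond k +
  -- 1.
  survivors-step : ∀ (t : Fin τ) y →
    survivors (suc (toℕ t)) y * remaining (toℕ t) ≤ (τ ∸ suc (toℕ t)) * survivors (toℕ t) y
  survivors-step t y = +-cancelˡ-≤ (suc k * N) _ _ (*-cancelˡ-≤ D (begin
    D * (suc k * N + N′ * m)          ≡⟨ lemma₁ D (suc k) N N′ m ⟩
    D * N′ * m + suc k * D * N        ≤⟨ +-monoʳ-≤ (D * N′ * m) (*-monoˡ-≤ N (θ-lower (toℕ t))) ⟩
    D * N′ * m + θ (toℕ t) * m * N    ≡⟨ lemma₂ D N′ m (θ (toℕ t)) N ⟩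
    (D * N′ + θ (toℕ t) * N) * m      ≤⟨ *-monoˡ-≤ m (decay t y) ⟩
    D * N * m                         ≡⟨ lemma₃ D N (suc k) (τ ∸ suc (toℕ t)) ⟩
    D * (suc k * N + (τ ∸ suc (toℕ t)) * N) ∎))
    where
    open ≤-Reasoning
    m = remaining (toℕ t)
    N = survivors (toℕ t) y
    N′ = survivors (suc (toℕ t)) y
    lemma₁ : ∀ D K N N′ m → D * (K * N + N′ * m) ≡ D * N′ * m + K * D * N
    lemma₁ = solve-∀
    lemma₂ : ∀ D N′ m θ N → D * N′ * m + θ * m * N ≡ (D * N′ + θ * N) * m
    lemma₂ = solve-∀
    lemma₃ : ∀ D N K j → D * N * (K + j) ≡ D * (K * N + j * N)
    lemma₃ = solve-∀

  survivors-bound : ∀ t y → t < τ → survivors t y * R ≤ rising (suc k) (τ ∸ suc t) * Total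
  survivors-bound zero y _ = begin
    survivors 0 y * R ≤⟨ *-monoˡ-≤ R (≤-trans (∑-≤-const Ω* (λ ω → 𝟙≤1 (survives (radii ω) 0 y)))
                                             (≤-reflexive (*-identityʳ Total))) ⟩
    Total * R         ≡⟨ *-comm Total R ⟩
    R * Total         ∎
    where
    open ≤-Reasoning
    open Parameters.Run n k τ b θ G using (radii)
  survivors-bound (suc t) y t<τ = *-cancelʳ-≤ _ _ (remaining t) (begin
    N′ * R * m                        ≡⟨ lemma₁ N′ R m ⟩
    N′ * m * R                        ≤⟨ *-monoˡ-≤ R step′ ⟩
    suc j * N * R                     ≡⟨ *-assoc (suc j) N R ⟩
    suc j * (N * R)                   ≤⟨ *-monoʳ-≤ (suc j) (survivors-bound t y (<-trans (n<1+n t) t<τ)) ⟩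
    suc j * (rising (suc k) (τ ∸ suc t) * Total) ≡⟨ cong (λ i → suc j * (rising (suc k) i * Total)) j≡ ⟩
    suc j * (rising (suc k) (suc j) * Total)     ≡⟨ lemma₂ (suc j) (rising (suc k) (suc j)) Total ⟩
    rising (suc k) (suc j) * suc j * Total       ≡⟨ cong (_* Total) (rising-shift (suc k) j) ⟩
    rising (suc k) j * (suc j + suc k) * Total   ≡⟨ cong (λ i → rising (suc k) j * i * Total) (trans (cong (_+ suc k) (sym j≡)) (+-comm _ (suc k))) ⟩
    rising (suc k) j * m * Total                 ≡⟨ lemma₁ (rising (suc k) j) m Total ⟩
    rising (suc k) j * Total * m                 ∎)
    where
    open ≤-Reasoning
    j = τ ∸ suc (suc t)
    m = remaining t
    N = survivors t y
    N′ = survivors (suc t) y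
    j≡ : τ ∸ suc t ≡ suc j
    j≡ = +-∸-assoc 1 t<τ
    step′ : N′ * m ≤ suc j * N
    step′ = subst (λ i → N′ * m ≤ i * N) j≡
      (subst (λ s → survivors (suc s) y * remaining s ≤ (τ ∸ suc s) * survivors s y)
        (Fin.toℕ-fromℕ< (<-trans (n<1+n t) t<τ)) (survivors-step (Fin.fromℕ< (<-trans (n<1+n t) t<τ)) y))
    lemma₁ : ∀ x y z → x * y * z ≡ x * z * y
    lemma₁ = solve-∀
    lemma₂ : ∀ x y z → x * (y * z) ≡ y * x * z
    lemma₂ = solve-∀

  survivors-end : ∀ y → survivors τ y ≡ 0
  survivors-end y = n≤0⇒n≡0 (*-cancelʳ-≤ _ _ (remaining (τ ∸ 1)) (≤-trans last (≤-reflexive refl)))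
    where
    1+[τ∸1]≡τ : suc (τ ∸ 1) ≡ τ
    1+[τ∸1]≡τ = m+[n∸m]≡n {1} (>-nonZero⁻¹ τ)
    last : survivors τ y * remaining (τ ∸ 1) ≤ 0
    last = subst₂ (λ s j → survivors s y * remaining (τ ∸ 1) ≤ j * survivors (τ ∸ 1) y)
      1+[τ∸1]≡τ (trans (cong (τ ∸_) 1+[τ∸1]≡τ) (n∸n≡0 τ))
      (subst (λ s → survivors (suc s) y * remaining s ≤ (τ ∸ suc s) * survivors s y)
        (Fin.toℕ-fromℕ< (≤-reflexive 1+[τ∸1]≡τ)) (survivors-step (Fin.fromℕ< (≤-reflexive 1+[τ∸1]≡τ)) y))

  overflows-bound : ∀ (t : Fin τ) v → overflows t v * R ≤ (k + 2) ^ suc k * Total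
  overflows-bound t v = *-cancelʳ-≤ _ _ (m ^ suc k) {{m^n≢0 m (suc k)}} (*-cancelˡ-≤ (D ^ suc k) {{m^n≢0 D (suc k)}} (begin
    D ^ suc k * (O * R * m ^ suc k)              ≡⟨ lemma₁ (D ^ suc k) O R (m ^ suc k) ⟩
    D ^ suc k * O * (m ^ suc k * R)              ≡⟨ cong (λ l → l * O * (m ^ suc k * R)) (length-blocks b (suc k)) ⟨
    length Block* * O * (m ^ suc k * R)          ≡⟨ cong (_* (m ^ suc k * R)) (∑-overflows t v) ⟩
    θ t′ ^ suc k * N * (m ^ suc k * R)           ≡⟨ lemma₂ (θ t′ ^ suc k) N (m ^ suc k) R ⟩
    θ t′ ^ suc k * m ^ suc k * (N * R)           ≡⟨ cong (_* (N * R)) (^-*-distrib (θ t′) m (suc k)) ⟨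
    (θ t′ * m) ^ suc k * (N * R)
      ≤⟨ *-mono-≤ (^-monoˡ-≤ (suc k) (θ-upper τ+k≤D (Fin.toℕ<n t))) (survivors-bound t′ v (Fin.toℕ<n t)) ⟩
    ((k + 2) * D) ^ suc k * (rising (suc k) (τ ∸ suc t′) * Total)
      -- The largest factor of this product is `remaining t`, so its bound m^(k + 1) cancels with
      -- the powers of m on the left.
      ≤⟨ *-monoʳ-≤ (((k + 2) * D) ^ suc k) (*-monoˡ-≤ Total (rising-≤ (suc k) (τ ∸ suc t′))) ⟩
    ((k + 2) * D) ^ suc k * (m ^ suc k * Total)  ≡⟨ cong (_* (m ^ suc k * Total)) (^-*-distrib (k + 2) D (suc k)) ⟩
    (k + 2) ^ suc k * D ^ suc k * (m ^ suc k * Total) ≡⟨ lemma₃ ((k + 2) ^ suc k) (D ^ suc k) (m ^ suc k) Total ⟩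
    D ^ suc k * ((k + 2) ^ suc k * Total * m ^ suc k) ∎))
    where
    open ≤-Reasoning
    t′ = toℕ t
    m = remaining t′
    N = survivors t′ v
    O = overflows t v
    lemma₁ : ∀ x y z w → x * (y * z * w) ≡ x * y * (w * z)
    lemma₁ = solve-∀
    lemma₂ : ∀ x y z w → x * y * (z * w) ≡ x * z * (y * w)
    lemma₂ = solve-∀
    lemma₃ : ∀ x y z w → x * y * (z * w) ≡ y * (x * w * z)
    lemma₃ = solve-∀

  failures-bound : failures * τ ^ k ≤ n * ((k + 2) ^ suc k * Total)
  failures-bound = *-cancelˡ-≤ τ (begin
    τ * (failures * τ ^ k)
      ≡⟨ lemma τ failures (τ ^ k) ⟩
    failures * τ ^ suc k
      -- Of these k + 1 factors τ, one pays for the sum over the τ phases.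
      ≤⟨ *-monoʳ-≤ failures τ^≤R ⟩
    failures * R
      ≤⟨ *-monoˡ-≤ R failures-≤ ⟩
    (∑ (allFin τ) (λ t → ∑ (allFin n) (overflows t)) + ∑ (allFin n) (survivors τ)) * R
      ≡⟨ cong (λ s → (∑ (allFin τ) (λ t → ∑ (allFin n) (overflows t)) + s) * R) (∑≡0 (allFin n) survivors-end) ⟩
    (∑ (allFin τ) (λ t → ∑ (allFin n) (overflows t)) + 0) * R
      ≡⟨ cong (_* R) (+-identityʳ (∑ (allFin τ) (λ t → ∑ (allFin n) (overflows t)))) ⟩
    ∑ (allFin τ) (λ t → ∑ (allFin n) (overflows t)) * R
      ≡⟨ *-comm _ R ⟩
    R * ∑ (allFin τ) (λ t → ∑ (allFin n) (overflows t))
      ≡⟨ ∑-* R (allFin τ) _ ⟩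
    ∑ (allFin τ) (λ t → R * ∑ (allFin n) (overflows t))
      ≤⟨ ∑-≤-const (allFin τ) (λ t → ≤-trans (≤-reflexive (∑-* R (allFin n) (overflows t)))
           (∑-≤-const (allFin n) (λ v → ≤-trans (≤-reflexive (*-comm R (overflows t v))) (overflows-bound t v)))) ⟩
    length (allFin τ) * (length (allFin n) * ((k + 2) ^ suc k * Total))
      ≡⟨ cong₂ (λ x y → x * (y * ((k + 2) ^ suc k * Total))) (List.length-tabulate {n = τ} (λ x → x)) (List.length-tabulate {n = n} (λ x → x)) ⟩
    τ * (n * ((k + 2) ^ suc k * Total)) ∎)
    where
    open ≤-Reasoning
    lemma : ∀ x y z → x * (y * z) ≡ y * (x * z)
    lemma = solve-∀
    τ^≤R : τ ^ suc k ≤ R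
    τ^≤R = subst (λ s → s ^ suc k ≤ R) (m+[n∸m]≡n {1} (>-nonZero⁻¹ τ)) (^≤rising (suc k) (τ ∸ 1))

-- Choice of parameters and assembly of the theorem

length-filterᵇ : ∀ {A : Set} (E : A → Bool) xs → length (filterᵇ E xs) ≡ ∑ xs (𝟙 ∘ E)
length-filterᵇ E []       = refl
length-filterᵇ E (x ∷ xs) with E x
... | true  = cong suc (length-filterᵇ E xs)
... | false = length-filterᵇ E xs

∑-complement : ∀ {A : Set} (E : A → Bool) xs → ∑ xs (𝟙 ∘ E) + ∑ xs (𝟙 ∘ not ∘ E) ≡ length xs
∑-complement E []       = refl
∑-complement E (x ∷ xs) with E x
... | true  = cong suc (∑-complement E xs)
... | false = trans (+-suc _ _) (cong suc (∑-complement E xs))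

pushes-length : ∀ {A B : Set} {g : A → B} {xs ys} → Pushes g xs ys → length xs ≡ length ys
pushes-length {xs = xs} {ys} p = begin
  length xs            ≡⟨ *-identityʳ _ ⟨
  length xs * 1        ≡⟨ ∑-const xs 1 ⟨
  ∑ xs (const 1)       ≡⟨ p (const 1) ⟩
  ∑ ys (const 1)       ≡⟨ ∑-const ys 1 ⟩
  length ys * 1        ≡⟨ *-identityʳ _ ⟩
  length ys            ∎
  where open ≡-Reasoning

module _ {n : ℕ} {G : Graph n} {f g : Fin n → ℕ} (f≗g : ∀ v → f v ≡ g v) where

  strongDiameter-cong : ∀ {D C} → StrongDiameterAtMost G D (Cluster G g C) → StrongDiameterAtMost G D (Cluster G f C)
  strongDiameter-cong diam u v fu fv =
    let d , (p , min) , d≤D = diam u v (trans (sym (f≗g u)) fu) (trans (sym (f≗g v)) fv) in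
    d , (walk-map (λ {w} → trans (f≗g w)) p , λ ℓ q → min ℓ (walk-map (λ {w} → trans (sym (f≗g w))) q)) , d≤D

  colorable-cong : ∀ {m} → SupergraphColorable G g m → SupergraphColorable G f m
  colorable-cong (color , proper) = color , λ { C C′ (C≢C′ , u , v , fu , fv , a) →
    proper C C′ (C≢C′ , u , v , trans (sym (f≗g u)) fu , trans (sym (f≗g v)) fv , a) }

module Choice (n k : ℕ) (c : ℝ) where

  C τ b : ℕ
  C = proj₁ (ceiling c)
  τ = 2 * k * root↑ k (C * n)
  b = ⌈log₂ (τ + k) ⌉

  open Schedule k τ (2 ^ b) using (θ) public
  open Parameters n k τ b θ public

algorithm : Algorithm
algorithm n k c = Choice.protocol n k c

module Correctness (n : ℕ) (G : Graph n) (k : ℕ) .{{k≢0 : NonZero k}} (c : ℝ)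
  (k≤ln : k ≤ln n) (5<c : ⟦ fromℕ 5 ⟧ <ℝ c) where
  open Choice n k c using (τ; b; tosses; coinsPerVertex; Block; protocol; numberLength; length-encode; module Run)
  open Run G using (radii; labels; clustering≡labels; module Decomposition)
  open Ceiling c 5<c using (C; 5<C)
  open RealRoot n k c 5<c k≤ln
  open Execution protocol G using (Coins; clustering; MessagesAtMost)

  instance
    y≢0 : NonZero y
    y≢0 = let _ , y≡ , _ = root↑-least k (C * n) in subst NonZero (sym y≡) _
    τ≢0 : NonZero τ
    τ≢0 = m*n≢0 (2 * k) y {{m*n≢0 2 k}}

  open FailureBound n k τ b (n≤2^⌈log₂n⌉ (τ + k)) G using (Ω*; Block*; failures; labelled?; failures-bound)

  allLabelled : Coins → Bool
  allLabelled ω = does (labelled? (radii (Vec.map tosses ω)))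

  decomposition : ∀ ω → allLabelled ω ≡ true →
    IsStrongDecomposition G (clustering ω) (2 * k ∸ 2) ((4 * k) · root k (n · c))
  decomposition ω all =
    (λ C → strongDiameter-cong (clustering≡labels ω 0<k) (strong-diameter labelled C)) ,
    τ , ≤-multiple τ (4 * k) (≤-reflexive (lemma k y)) ,
    colorable-cong {G = G} {clustering ω} {labels (radii (Vec.map tosses ω)) τ} (clustering≡labels ω 0<k) (colourable labelled)
    where
    open Decomposition (radii (Vec.map tosses ω))
    labelled = does-true (labelled? (radii (Vec.map tosses ω))) all
    0<k : 0 < k
    0<k = >-nonZero⁻¹ k
    lemma : ∀ k y → 2 * (2 * k * y) ≡ 4 * k * y
    lemma = solve-∀

  -- Passes from the flat coin strings of the protocol to the independent blocks in which the
  -- failures were counted.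
  tosses-pushes : Pushes (Vec.map tosses) (allCoins coinsPerVertex n) Ω*
  tosses-pushes = map-pushes {g = tosses} {allVecs coin coinsPerVertex} {allVecs Block* τ} n λ f → trans
    (chunks-pushes coin τ (suc k * b) (f ∘ Vec.map (chunks (suc k))))
    (map-pushes τ (chunks-pushes coin (suc k) b) f)

  failures*C≤5*total : failures * C ≤ 5 * length (allCoins coinsPerVertex n)
  failures*C≤5*total = subst (λ t → failures * C ≤ 5 * t) (sym (pushes-length {g = Vec.map tosses} {allCoins coinsPerVertex n} {Ω*} tosses-pushes))
    (*-cancelʳ-≤ _ _ n (*-cancelʳ-≤ _ _ ((2 * k) ^ k) {{m^n≢0 (2 * k) k {{m*n≢0 2 k}}}} (begin
      failures * C * n * K                      ≡⟨ lemma₁ failures C n K ⟩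
      failures * (K * (C * n))                  ≤⟨ *-monoʳ-≤ failures (*-monoʳ-≤ K (root↑-≥ k (C * n))) ⟩
      failures * (K * y ^ k)                    ≡⟨ cong (failures *_) (^-*-distrib (2 * k) y k) ⟨
      failures * τ ^ k                          ≤⟨ failures-bound ⟩
      n * ((k + 2) ^ suc k * length Ω*)         ≤⟨ *-monoʳ-≤ n (*-monoˡ-≤ (length Ω*) (factor-bound k)) ⟩
      n * (5 * K * length Ω*)                   ≡⟨ lemma₂ n K (length Ω*) ⟩
      5 * length Ω* * n * K                     ∎)))
    where
    open ≤-Reasoning
    K = (2 * k) ^ k
    lemma₁ : ∀ f C n K → f * C * n * K ≡ f * (K * (C * n))
    lemma₁ = solve-∀
    lemma₂ : ∀ n K T → n * (5 * K * T) ≡ 5 * T * n * K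
    lemma₂ = solve-∀

  probability : ProbabilityAtLeast (1ℚ ⊖ 5 · recip c (5<⇒0< c 5<c))
    (λ ω → IsStrongDecomposition G (clustering ω) (2 * k ∸ 2) ((4 * k) · root k (n · c)))
  probability = allLabelled , decomposition ,
    probability-bound c (5<⇒0< c 5<c) C (length (filterᵇ allLabelled coins)) failures (length coins)
      {{outcomes≢0}} (proj₁ (proj₂ (ceiling c)))
      (trans (cong₂ _+_ (length-filterᵇ allLabelled coins) (sym (tosses-pushes _))) (∑-complement allLabelled coins))
      failures*C≤5*total
    where
    coins = allCoins coinsPerVertex n
    outcomes≢0 : NonZero (length coins)
    outcomes≢0 = subst NonZero (sym (length-allCoins coinsPerVertex n))
      (m^n≢0 (2 ^ coinsPerVertex) n {{m^n≢0 2 coinsPerVertex}})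

  rounds-bound : ⟦ fromℕ (Protocol.rounds protocol) ⟧ ≤ℝ (4 * k ^ 2) · root k (n · c)
  rounds-bound = ≤-multiple (τ * k) (4 * k ^ 2) (≤-reflexive (lemma k y))
    where
    lemma : ∀ k y → 2 * (2 * k * y * k) ≡ 4 * (k * (k * 1)) * y
    lemma = solve-∀

  messages-bound : MessagesAtMost (4 * wordLength n)
  messages-bound ω t u v _ _ = ≤-trans (≤-reflexive (length-encode _ _)) (begin
    numberLength + numberLength    ≤⟨ +-mono-≤ (+-monoˡ-≤ w 1≤w) (+-monoˡ-≤ w 1≤w) ⟩
    w + w + (w + w)                ≡⟨ lemma w ⟩
    4 * w                          ∎)
    where
    open ≤-Reasoning
    w = wordLength n
    -- Since n ≥ 2^k ≥ 2, the extra bit of each number fits into one more word.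
    1≤w : 1 ≤ w
    1≤w = ⌈log₂⌉-mono-≤ {2} {n} (≤-trans (^-monoʳ-≤ 2 (>-nonZero⁻¹ k)) 2^k≤n)
    lemma : ∀ w → w + w + (w + w) ≡ 4 * w
    lemma = solve-∀

theorem2 :
    ∃ λ (𝒜 : Algorithm) → ∃ λ (A : ℕ) → ∃ λ (B : ℕ) →
      ∀ (n : ℕ) (G : Graph n) (k : ℕ) .{{_ : NonZero k}} (c : ℝ) →
      k ≤ln n → (5<c : ⟦ fromℕ 5 ⟧ <ℝ c) →
      let P = 𝒜 n k c
          open Execution P G
          [cn]^1/k = root k (n · c)
      in
        ProbabilityAtLeast (1ℚ ⊖ 5 · recip c (5<⇒0< c 5<c))
          (λ ω → IsStrongDecomposition G (clustering ω) (2 * k ∸ 2) ((4 * k) · [cn]^1/k))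
        × ⟦ fromℕ (Protocol.rounds P) ⟧ ≤ℝ (A * k ^ 2) · [cn]^1/k
        × MessagesAtMost (B * wordLength n)
theorem2 = algorithm , 4 , 4 , λ n G k c k≤ln 5<c →
  let open Correctness n G k c k≤ln 5<c in probability , rounds-bound , messages-bound
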